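{- (1) For every sub-identical order function $f\colon \mathbb{N} \to [0,\infty)$ there is a fast-growing order function $q\colon \mathbb{N} \to (1,\infty)$ such that $\mathrm{LUA}(q) \leq_{\mathrm{s}} \mathrm{COMPLEX}(f)$. (2) For every fast-growing order function $p\colon \mathbb{N} \to (1,\infty)$ there is a sub-identical order function $g\colon \mathbb{N} \to [0,\infty)$ such that $\mathrm{COMPLEX}(g) \leq_{\mathrm{s}} \mathrm{LUA}(p)$.
   Context: An order function is a computable (i.e. its values are uniformly computable reals), nondecreasing, unbounded function $\mathbb{N}\to\mathbb{R}$. A function $f\colon\mathbb{N}\to[0,\infty)$ is sub-identical if $\lim_{n\to\infty}(n-f(n))=\infty$. An order function $p\colon\mathbb{N}\to(1,\infty)$ is fast-growing if $\sum_{n=0}^\infty p(n)^{ -1}<\infty$. Prefix-free complexity: a prefix-free machine is a partial recursive $M$ from $\{0,1\}^*$ to $\{0,1\}^*$ with prefix-free domain; $U$ is universal if for each prefix-free machine $M$ there is $\rho$ with $U(\rho^\frown\tau)\simeq M(\tau)$ for all $\tau$. Fix a universal $U$ and let $K(\sigma)=\min\{|\tau| : U(\tau)=\sigma\}$. For $f\colon\mathbb{N}\to\mathbb{R}$, $\mathrm{COMPLEX}(f)$ is the set of $X\in\{0,1\}^{\mathbb{N}}$ for which there is $c\in\mathbb{N}$ with $K(X\upharpoonright n)\geq f(n)-c$ for all $n$. A partial recursive $\psi\colon\subseteq\mathbb{N}\to\mathbb{N}$ is linearly universal if for every partial recursive $\theta\colon\subseteq\mathbb{N}\to\mathbb{N}$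 there are $a,b\in\mathbb{N}$ with $\psi(ax+b)\simeq\theta(x)$ for all $x$. For $p\colon\mathbb{N}\to(1,\infty)$, $\mathrm{LUA}(p)$ is the set of $X\in\mathbb{N}^{\mathbb{N}}$ such that $X(n)<p(n)$ for all $n$ and, for some linearly universal partial recursive $\psi$, there is no $n\in\operatorname{dom}\psi$ with $X(n)=\psi(n)$. For $P,Q\subseteq\mathbb{N}^{\mathbb{N}}$, $P\leq_{\mathrm{s}}Q$ (strong/Medvedev reducibility) means there is a partial recursive functional defined on all of $Q$ that maps $Q$ into $P$. -}

module Defs where

open import Data.Bool.Base using (Bool; true; false; if_then_else_)
open import Data.Empty using (⊥; ⊥-elim)
open import Data.Fin.Base using (Fin)
open import Data.Integer.Base using (+_; _⊖_)
open import Data.List.Base using (List; []; _∷_; _++_; length; applyUpTo)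
open import Data.List.Relation.Binary.Prefix.Heterogeneous using (Prefix)
open import Data.Nat.Base as ℕ using (ℕ; zero; suc)
open import Data.Product.Base using (Σ; ∃-syntax; _×_; _,_)
open import Data.Rational.Base as ℚ using (ℚ; 0ℚ; 1ℚ; ½; 1/_; _⊔_)
import Data.Rational.Properties as ℚₚ
open import Data.Rational.Solver using (module +-*-Solver)
open import Data.Unit.Base using (⊤)
open import Data.Vec.Base as Vec using (Vec; []; _∷_)
open import Function.Bundles using (_⇔_)
open import Relation.Binary.PropositionalEquality
  using (_≡_; refl; sym; trans; cong; cong₂; subst; subst₂)
open import Relation.Nullary.Negation.Core using (¬_)
open import Relation.Unary using (Pred)
open import Level using (0ℓ)

------------------------------------------------------------------------
-- Real numbers

2⁻ : ℕ → ℚ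
2⁻ zero    = 1ℚ
2⁻ (suc k) = ½ ℚ.* 2⁻ k

2⁻-half : ∀ k → 2⁻ (suc k) ℚ.+ 2⁻ (suc k) ≡ 2⁻ k
2⁻-half k = trans (sym (ℚₚ.*-distribʳ-+ (2⁻ k) ½ ½)) (ℚₚ.*-identityˡ (2⁻ k))

2⁻-nonNeg : ∀ k → 0ℚ ℚ.≤ 2⁻ k
2⁻-nonNeg zero    = ℚₚ.nonNegative⁻¹ 1ℚ
2⁻-nonNeg (suc k) =
  subst (ℚ._≤ 2⁻ (suc k)) (ℚₚ.*-zeroʳ ½) (ℚₚ.*-monoˡ-≤-nonNeg ½ (2⁻-nonNeg k))

-- Since m and n may be exchanged, `regular` bounds the distance
-- |approx m - approx n|; so approx k is within 2⁻ k of the real it denotes.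
record ℝ : Set where
  constructor mkℝ
  field
    approx  : ℕ → ℚ
    regular : ∀ m n → approx m ℚ.≤ approx n ℚ.+ (2⁻ m ℚ.+ 2⁻ n)
open ℝ public

infix 4 _≤ℝ_ _<ℝ_

_≤ℝ_ : ℝ → ℝ → Set
x ≤ℝ y = ∀ k → approx x k ℚ.≤ approx y k ℚ.+ (2⁻ k ℚ.+ 2⁻ k)

_<ℝ_ : ℝ → ℝ → Set
x <ℝ y = ∃[ k ] approx x k ℚ.+ (2⁻ k ℚ.+ 2⁻ k) ℚ.< approx y k

fromℚ : ℚ → ℝ
fromℚ q = mkℝ (λ _ → q) λ m n →
  subst (ℚ._≤ q ℚ.+ (2⁻ m ℚ.+ 2⁻ n)) (ℚₚ.+-identityʳ q)
    (ℚₚ.+-monoʳ-≤ q (ℚₚ.+-mono-≤ (2⁻-nonNeg m) (2⁻-nonNeg n)))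

fromℕ : ℕ → ℝ
fromℕ n = fromℚ ((+ n) ℚ./ 1)

infixl 6 _+ℝ_ _-ℝ_
infix  8 -ℝ_

-ℝ_ : ℝ → ℝ
-ℝ x = mkℝ (λ k → ℚ.- approx x k) λ m n →
  subst₂ ℚ._≤_
    (solve 3 (λ a b e → (:- a :+ :- b) :+ b := :- a) refl (approx x m) (approx x n) 0ℚ)
    (solve 4 (λ a b d e → (:- a :+ :- b) :+ (a :+ (e :+ d)) := :- b :+ (d :+ e)) refl
       (approx x m) (approx x n) (2⁻ m) (2⁻ n))
    (ℚₚ.+-monoʳ-≤ (ℚ.- approx x m ℚ.+ ℚ.- approx x n) (regular x n m))
  where open +-*-Solver

-- The shift of the index keeps the sum regular.
_+ℝ_ : ℝ → ℝ → ℝ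
x +ℝ y = mkℝ (λ k → approx x (suc k) ℚ.+ approx y (suc k)) λ m n →
  subst (approx x (suc m) ℚ.+ approx y (suc m) ℚ.≤_)
    (trans
      (solve 4 (λ a b d e → (a :+ (d :+ e)) :+ (b :+ (d :+ e))
                         := (a :+ b) :+ ((d :+ d) :+ (e :+ e))) refl
         (approx x (suc n)) (approx y (suc n)) (2⁻ (suc m)) (2⁻ (suc n)))
      (cong (approx x (suc n) ℚ.+ approx y (suc n) ℚ.+_)
         (cong₂ ℚ._+_ (2⁻-half m) (2⁻-half n))))
    (ℚₚ.+-mono-≤ (regular x (suc m) (suc n)) (regular y (suc m) (suc n)))
  where open +-*-Solver

_-ℝ_ : ℝ → ℝ → ℝ
x -ℝ y = x +ℝ (-ℝ y)

1⊔-pos : ∀ q → ℚ.Positive (1ℚ ⊔ q)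
1⊔-pos q = ℚ.positive (ℚₚ.<-≤-trans (ℚₚ.positive⁻¹ 1ℚ) (ℚₚ.p≤p⊔q 1ℚ q))

1/1⊔ : ℚ → ℚ
1/1⊔ q = (1/ (1ℚ ⊔ q)) {{ℚₚ.pos⇒nonZero (1ℚ ⊔ q) {{1⊔-pos q}}}}

1/1⊔-lipschitz : ∀ p q d → 0ℚ ℚ.≤ d → q ℚ.≤ p ℚ.+ d → 1/1⊔ p ℚ.≤ 1/1⊔ q ℚ.+ d
1/1⊔-lipschitz p q d 0≤d q≤p+d =
  ℚₚ.*-cancelˡ-≤-pos (a ℚ.* b) {{ℚₚ.pos*pos⇒pos a b}} main
  where
  open +-*-Solver
  open ℚₚ.≤-Reasoning
  a b : ℚ
  a = 1ℚ ⊔ p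
  b = 1ℚ ⊔ q
  instance
    a>0 : ℚ.Positive a
    a>0 = 1⊔-pos p
    b>0 : ℚ.Positive b
    b>0 = 1⊔-pos q
    a≥0 : ℚ.NonNegative a
    a≥0 = ℚₚ.pos⇒nonNeg a
    d≥0 : ℚ.NonNegative d
    d≥0 = ℚ.nonNegative 0≤d
  b≤a+d : b ℚ.≤ a ℚ.+ d
  b≤a+d = ℚₚ.⊔-lub
    (subst (ℚ._≤ a ℚ.+ d) (ℚₚ.+-identityʳ 1ℚ) (ℚₚ.+-mono-≤ (ℚₚ.p≤p⊔q 1ℚ p) 0≤d))
    (ℚₚ.≤-trans q≤p+d (ℚₚ.+-monoˡ-≤ d (ℚₚ.p≤q⊔p 1ℚ p)))
  d≤abd : d ℚ.≤ a ℚ.* b ℚ.* d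
  d≤abd = begin
    d                 ≡⟨ sym (ℚₚ.*-identityˡ d) ⟩
    1ℚ ℚ.* d          ≤⟨ ℚₚ.*-monoʳ-≤-nonNeg d (ℚₚ.p≤p⊔q 1ℚ p) ⟩
    a ℚ.* d           ≡⟨ cong (ℚ._* d) (sym (ℚₚ.*-identityʳ a)) ⟩
    a ℚ.* 1ℚ ℚ.* d    ≤⟨ ℚₚ.*-monoʳ-≤-nonNeg d (ℚₚ.*-monoˡ-≤-nonNeg a (ℚₚ.p≤p⊔q 1ℚ q)) ⟩
    a ℚ.* b ℚ.* d     ∎
  inv : ∀ x y → .{{_ : ℚ.NonZero x}} → x ℚ.* y ℚ.* (1/ x) ≡ y
  inv x y = trans
    (solve 3 (λ x y z → x :* y :* z := (x :* z) :* y) refl x y (1/ x))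
    (trans (cong (ℚ._* y) (ℚₚ.*-inverseʳ x)) (ℚₚ.*-identityˡ y))
  main : a ℚ.* b ℚ.* 1/1⊔ p ℚ.≤ a ℚ.* b ℚ.* (1/1⊔ q ℚ.+ d)
  main = begin
    a ℚ.* b ℚ.* 1/1⊔ p        ≡⟨ inv a b {{ℚₚ.pos⇒nonZero a}} ⟩
    b                         ≤⟨ b≤a+d ⟩
    a ℚ.+ d                   ≤⟨ ℚₚ.+-monoʳ-≤ a d≤abd ⟩
    a ℚ.+ a ℚ.* b ℚ.* d
      ≡⟨ cong (ℚ._+ a ℚ.* b ℚ.* d) (sym (trans (cong (ℚ._* 1/1⊔ q) (ℚₚ.*-comm a b))
           (inv b a {{ℚₚ.pos⇒nonZero b}}))) ⟩
    a ℚ.* b ℚ.* 1/1⊔ q ℚ.+ a ℚ.* b ℚ.* d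
      ≡⟨ sym (ℚₚ.*-distribˡ-+ (a ℚ.* b) (1/1⊔ q) d) ⟩
    a ℚ.* b ℚ.* (1/1⊔ q ℚ.+ d) ∎

-- x⁻¹ for x > 1.  As x = max(1, x), truncating the approximations at 1 from
-- below does not change the limit, and makes inversion 1-Lipschitz.
recip : (x : ℝ) → fromℕ 1 <ℝ x → ℝ
recip x _ = mkℝ (λ k → 1/1⊔ (approx x k)) λ m n →
  1/1⊔-lipschitz (approx x m) (approx x n) (2⁻ m ℚ.+ 2⁻ n)
    (ℚₚ.+-mono-≤ (2⁻-nonNeg m) (2⁻-nonNeg n))
    (subst (λ e → approx x n ℚ.≤ approx x m ℚ.+ e) (ℚₚ.+-comm (2⁻ n) (2⁻ m))
      (regular x n m))

∑<_ : ℕ → (ℕ → ℝ) → ℝ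
(∑< zero)  a = fromℕ 0
(∑< suc n) a = (∑< n) a +ℝ a n

TendsTo : (ℕ → ℝ) → ℝ → Set
TendsTo a s = ∀ (ε : ℝ) → fromℕ 0 <ℝ ε →
  ∃[ N ] (∀ n → N ℕ.≤ n → (s -ℝ ε <ℝ a n) × (a n <ℝ s +ℝ ε))

TendsTo∞ : (ℕ → ℝ) → Set
TendsTo∞ a = ∀ (B : ℝ) → ∃[ N ] (∀ n → N ℕ.≤ n → B <ℝ a n)

Summable : (ℕ → ℝ) → Set
Summable a = ∃[ s ] TendsTo (λ n → (∑< n) a) s

------------------------------------------------------------------------
-- Partial recursive functions and functionals (μ-recursive schemes).
-- O indexes the oracles, each of which is a total function ℕ → ℕ.

data Code (O : Set) : ℕ → Set where
  zer    : Code O 0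
  suc    : Code O 1
  proj   : ∀ {n} → Fin n → Code O n
  oracle : O → Code O 1
  comp   : ∀ {m n} → Code O m → Vec (Code O n) m → Code O n
  prec   : ∀ {n} → Code O n → Code O (2 ℕ.+ n) → Code O (1 ℕ.+ n)
  mu     : ∀ {n} → Code O (1 ℕ.+ n) → Code O n

-- Eval α e xs y : the computation of e with oracles α on the arguments xs
-- halts with value y.
mutual
  data Eval {O : Set} (α : O → ℕ → ℕ) : ∀ {n} → Code O n → Vec ℕ n → ℕ → Set where
    e-zer    : Eval α zer [] 0
    e-suc    : ∀ {x} → Eval α suc (x ∷ []) (suc x)
    e-proj   : ∀ {n} {i : Fin n} {xs} → Eval α (proj i) xs (Vec.lookup xs i)
    e-oracle : ∀ {o x} → Eval α (oracle o) (x ∷ []) (α o x)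
    e-comp   : ∀ {m n} {f : Code O m} {gs : Vec (Code O n) m} {xs ys z} →
               Evals α gs xs ys → Eval α f ys z → Eval α (comp f gs) xs z
    e-prec-0 : ∀ {n} {f : Code O n} {g xs y} →
               Eval α f xs y → Eval α (prec f g) (0 ∷ xs) y
    e-prec-s : ∀ {n} {f : Code O n} {g k xs r y} →
               Eval α (prec f g) (k ∷ xs) r → Eval α g (k ∷ r ∷ xs) y →
               Eval α (prec f g) (suc k ∷ xs) y
    e-mu     : ∀ {n} {f : Code O (1 ℕ.+ n)} {xs y} →
               (∀ z → z ℕ.< y → ∃[ v ] Eval α f (z ∷ xs) (suc v)) →
               Eval α f (y ∷ xs) 0 → Eval α (mu f) xs y

  data Evals {O : Set} (α : O → ℕ → ℕ) {n : ℕ} :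
             ∀ {m} → Vec (Code O n) m → Vec ℕ n → Vec ℕ m → Set where
    []  : ∀ {xs} → Evals α [] xs []
    _∷_ : ∀ {m g y xs} {gs : Vec (Code O n) m} {ys} →
          Eval α g xs y → Evals α gs xs ys → Evals α (g ∷ gs) xs (y ∷ ys)

PartialRecursive : ℕ → Set
PartialRecursive n = Code ⊥ n

infix 4 _⟨_⟩↦_
_⟨_⟩↦_ : ∀ {n} → PartialRecursive n → Vec ℕ n → ℕ → Set
e ⟨ xs ⟩↦ y = Eval ⊥-elim e xs y

Functional : Set
Functional = Code ⊤ 1

infix 4 _^_⟨_⟩↦_
_^_⟨_⟩↦_ : Functional → (ℕ → ℕ) → ℕ → ℕ → Set
Φ ^ X ⟨ n ⟩↦ y = Eval (λ _ → X) Φ (n ∷ []) y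

Recursive₂ : (ℕ → ℕ → ℕ) → Set
Recursive₂ h = Σ (PartialRecursive 2) λ e → ∀ m n → e ⟨ m ∷ n ∷ [] ⟩↦ h m n

-- P ≤ₛ Q.  The quantifier over Y only names the total function computed by Φ
-- from X.
infix 4 _≤ₛ_
_≤ₛ_ : Pred (ℕ → ℕ) 0ℓ → Pred (ℕ → ℕ) 0ℓ → Set
P ≤ₛ Q = Σ Functional λ Φ →
  ∀ X → Q X → ∃[ Y ] P Y × (∀ n → Φ ^ X ⟨ n ⟩↦ Y n)

------------------------------------------------------------------------
-- Order functions

-- Uniformly computable reals: the n-th value is approximated to within 2⁻ k
-- by a rational number depending recursively on n and k.
Computable : (ℕ → ℝ) → Set
Computable f =
  ∃[ s ] ∃[ t ] ∃[ d ] Recursive₂ s × Recursive₂ t × Recursive₂ d ×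
  (∀ n k → let r = (s n k ⊖ t n k) ℚ./ suc (d n k) in
     (fromℚ (r ℚ.- 2⁻ k) ≤ℝ f n) × (f n ≤ℝ fromℚ (r ℚ.+ 2⁻ k)))

Nondecreasing : (ℕ → ℝ) → Set
Nondecreasing f = ∀ m n → m ℕ.≤ n → f m ≤ℝ f n

Unbounded : (ℕ → ℝ) → Set
Unbounded f = ∀ (B : ℝ) → ∃[ n ] B <ℝ f n

IsOrder : (ℕ → ℝ) → Set
IsOrder f = Computable f × Nondecreasing f × Unbounded f

SubIdentical : (ℕ → ℝ) → Set
SubIdentical f = TendsTo∞ (λ n → fromℕ n -ℝ f n)

-- For terms in (0,1) as here, convergence of the series is ∑ p(n)⁻¹ < ∞.
FastGrowing : (p : ℕ → ℝ) → (∀ n → fromℕ 1 <ℝ p n) → Set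
FastGrowing p p>1 = Summable (λ n → recip (p n) (p>1 n))

------------------------------------------------------------------------
-- Prefix-free complexity

String : Set
String = List Bool

-- Bijective base-2 numeration; a bijection from strings onto ℕ, through which
-- partial recursive functions on strings are understood.
encode : String → ℕ
encode []          = 0
encode (false ∷ σ) = 1 ℕ.+ 2 ℕ.* encode σ
encode (true  ∷ σ) = 2 ℕ.+ 2 ℕ.* encode σ

infix 4 _⟪_⟫↦_
_⟪_⟫↦_ : PartialRecursive 1 → String → String → Set
M ⟪ τ ⟫↦ σ = M ⟨ encode τ ∷ [] ⟩↦ encode σ

PrefixFree : PartialRecursive 1 → Set
PrefixFree M = ∀ {τ τ′ σ σ′} →
  M ⟪ τ ⟫↦ σ → M ⟪ τ′ ⟫↦ σ′ → Prefix _≡_ τ τ′ → τ ≡ τ′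

IsUniversal : PartialRecursive 1 → Set
IsUniversal U = PrefixFree U ×
  (∀ M → PrefixFree M → ∃[ ρ ] (∀ τ σ → (U ⟪ ρ ++ τ ⟫↦ σ) ⇔ (M ⟪ τ ⟫↦ σ)))

-- K[ U ] σ ≡ k as a relation: k is the least length of a U-description of σ.
K[_]_is_ : PartialRecursive 1 → String → ℕ → Set
K[ U ] σ is k =
  (∃[ τ ] (U ⟪ τ ⟫↦ σ) × length τ ≡ k) × (∀ τ → U ⟪ τ ⟫↦ σ → k ℕ.≤ length τ)

_↾_ : (ℕ → Bool) → ℕ → String
X ↾ n = applyUpTo X n

COMPLEX : PartialRecursive 1 → (ℕ → ℝ) → Pred (ℕ → Bool) 0ℓ
COMPLEX U f X =
  ∃[ c ] (∀ n → ∃[ k ] K[ U ] (X ↾ n) is k × (f n -ℝ fromℕ c ≤ℝ fromℕ k))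

-- A subset of {0,1}^ℕ viewed as a subset of ℕ^ℕ.
⌊_⌋ : Pred (ℕ → Bool) 0ℓ → Pred (ℕ → ℕ) 0ℓ
⌊ P ⌋ Y = ∃[ X ] P X × (∀ n → Y n ≡ (if X n then 1 else 0))

------------------------------------------------------------------------
-- Linearly universal avoidance

LinearlyUniversal : PartialRecursive 1 → Set
LinearlyUniversal ψ = ∀ (θ : PartialRecursive 1) → ∃[ a ] ∃[ b ]
  (∀ x y → (ψ ⟨ (a ℕ.* x ℕ.+ b) ∷ [] ⟩↦ y) ⇔ (θ ⟨ x ∷ [] ⟩↦ y))

LUA : (ℕ → ℝ) → Pred (ℕ → ℕ) 0ℓ
LUA p X = (∀ n → fromℕ (X n) <ℝ p n) ×
  (∃[ ψ ] LinearlyUniversal ψ × ¬ (∃[ n ] ψ ⟨ n ∷ [] ⟩↦ X n))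

{-# OPTIONS --safe #-}
module Submission where

-- (1) Let U(ρ0ˣ1) = θ(x).  If n codes the triple (ρ, 2^|ρ|, x) affinely in x, then
-- n ↦ U(ρ0ˣ1) is linearly universal, and so is its restriction ψ to n > c for any c.
-- Take m computable with f(m(n)) > n + (the code of ρ0ˣ1), and send X to the sequence
-- of codes of X↾m(n).  If the n-th term equals ψ(n), then ρ0ˣ1 describes X↾m(n), which
-- contradicts K(X↾m(n)) ≥ f(m(n)) − c.
--
-- (2) Send X to its graph Z.  Let θ take (a, b, τ), coded by z, to the value at az + b of
-- the function whose graph begins with U(τ).  If a, b witness linear universality of ψ for
-- this θ itself, and U(τ) = Z↾n with n large compared to az + b, then
-- ψ(az + b) = θ(z) = X(az + b).  So an X avoiding ψ has no τ that short, and how short is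
-- governed by the inverse of a computable function depending only on a bound for p.

open import Defs
open import Axiom.ExcludedMiddle using (ExcludedMiddle)
open import Data.Bool.Base using (Bool; true; false; if_then_else_)
open import Data.Empty using (⊥; ⊥-elim)
open import Data.Fin.Base using (Fin; zero; suc)
open import Data.Integer.Base as ℤ using (+_; -[1+_])
import Data.Integer.Properties as ℤₚ
open import Data.List.Base using (_++_; _∷ʳ_; []; _∷_; length; replicate)
open import Data.List.Properties using (applyUpTo-∷ʳ; length-applyUpTo)
open import Data.List.Relation.Binary.Prefix.Heterogeneous using (Prefix; _∷_)
open import Data.Nat.Base hiding (_⊔_)
open import Data.Nat.Induction using (<-rec)
open import Data.Nat.Properties
open import Data.Nat.Tactic.RingSolver using (solve-∀)
open import Data.Product.Base using (Σ; ∃-syntax; _×_; _,_; proj₁; proj₂)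
open import Data.Rational.Base as ℚ using (ℚ; 0ℚ; 1ℚ; ½; 1/_; _⊔_; fromℚᵘ; toℚᵘ)
import Data.Rational.Properties as ℚₚ
open import Data.Rational.Solver using (module +-*-Solver)
open import Data.Rational.Unnormalised.Base as ℚᵘ using (mkℚᵘ)
import Data.Rational.Unnormalised.Properties as ℚᵘₚ
open import Data.Sum.Base using (_⊎_; inj₁; inj₂)
open import Data.Unit.Base using (⊤; tt)
open import Data.Vec.Base using (Vec; []; _∷_; lookup)
open import Function.Bundles using (_⇔_; mk⇔; module Equivalence)
open import Level using (0ℓ)
open import Relation.Binary.Definitions using (tri<; tri≈; tri>)
open import Relation.Binary.PropositionalEquality
open import Relation.Nullary using (yes; no)
open import Relation.Nullary.Negation.Core using (¬_)

open Equivalence using (to; from)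

-- Evaluation and recursive functions

mutual
  -- In the `mu` case the smaller of two distinct results would test both as zero and as a
  -- successor. Determinism lets later soundness proofs read off the intermediate values of a given
  -- computation.
  Eval-det : ∀ {O : Set} {α : O → ℕ → ℕ} {n} (e : Code O n) {xs y y′} →
             Eval α e xs y → Eval α e xs y′ → y ≡ y′
  Eval-det zer e-zer e-zer = refl
  Eval-det suc e-suc e-suc = refl
  Eval-det (proj i) e-proj e-proj = refl
  Eval-det (oracle o) e-oracle e-oracle = refl
  Eval-det (comp f gs) (e-comp p q) (e-comp p′ q′) with refl ← Evals-det gs p p′ =
    Eval-det f q q′
  Eval-det (prec f g) (e-prec-0 p) (e-prec-0 p′) = Eval-det f p p′
  Eval-det (prec f g) (e-prec-s p q) (e-prec-s p′ q′)
    with refl ← Eval-det (prec f g) p p′ = Eval-det g q q′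
  Eval-det (mu f) {y = y} {y′} (e-mu below stop) (e-mu below′ stop′) with <-cmp y y′
  ... | tri≈ _ y≡y′ _ = y≡y′
  ... | tri< y<y′ _ _ with () ← Eval-det f stop (proj₂ (below′ y y<y′))
  ... | tri> _ _ y′<y with () ← Eval-det f stop′ (proj₂ (below y′ y′<y))

  Evals-det : ∀ {O : Set} {α : O → ℕ → ℕ} {m n} (es : Vec (Code O n) m) {xs ys ys′} →
              Evals α es xs ys → Evals α es xs ys′ → ys ≡ ys′
  Evals-det [] [] [] = refl
  Evals-det (e ∷ es) (p ∷ ps) (p′ ∷ ps′) =
    cong₂ _∷_ (Eval-det e p p′) (Evals-det es ps ps′)

mutual
  -- A code carries its type of oracles, so a recursive function has to be translated before a
  -- functional can call it.
  relativize : ∀ {O : Set} {n} → Code ⊥ n → Code O n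
  relativize zer         = zer
  relativize suc         = suc
  relativize (proj i)    = proj i
  relativize (comp f gs) = comp (relativize f) (relativizes gs)
  relativize (prec f g)  = prec (relativize f) (relativize g)
  relativize (mu f)      = mu (relativize f)

  relativizes : ∀ {O : Set} {m n} → Vec (Code ⊥ n) m → Vec (Code O n) m
  relativizes []       = []
  relativizes (e ∷ es) = relativize e ∷ relativizes es

mutual
  relativize-Eval : ∀ {O : Set} {α : O → ℕ → ℕ} {n} (e : Code ⊥ n) {xs y} →
                    Eval ⊥-elim e xs y → Eval α (relativize e) xs y
  relativize-Eval zer e-zer = e-zer
  relativize-Eval suc e-suc = e-suc
  relativize-Eval (proj i) e-proj = e-proj
  relativize-Eval (comp f gs) (e-comp p q) =
    e-comp (relativizes-Evals gs p) (relativize-Eval f q)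
  relativize-Eval (prec f g) (e-prec-0 p) = e-prec-0 (relativize-Eval f p)
  relativize-Eval (prec f g) (e-prec-s p q) =
    e-prec-s (relativize-Eval (prec f g) p) (relativize-Eval g q)
  relativize-Eval (mu f) (e-mu below stop) =
    e-mu (λ z z<y → proj₁ (below z z<y) , relativize-Eval f (proj₂ (below z z<y)))
         (relativize-Eval f stop)

  relativizes-Evals : ∀ {O : Set} {α : O → ℕ → ℕ} {m n} (es : Vec (Code ⊥ n) m) {xs ys} →
                      Evals ⊥-elim es xs ys → Evals α (relativizes es) xs ys
  relativizes-Evals [] [] = []
  relativizes-Evals (e ∷ es) (p ∷ ps) = relativize-Eval e p ∷ relativizes-Evals es ps

module _ {O : Set} where

  -- Values may depend on the oracles, so that the same combinators build recursive functions and
  -- functionals. This form is for expressions in a vector of variables; the curried `Rec₁`, `Rec₂`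
  -- and `Rec₃` are for functions applied by name.
  record Recursive {n} (F : (O → ℕ → ℕ) → Vec ℕ n → ℕ) : Set where
    constructor mkRec
    field
      code     : Code O n
      computes : ∀ α xs → Eval α code xs (F α xs)

  record Rec₁ (f : (O → ℕ → ℕ) → ℕ → ℕ) : Set where
    constructor mkRec₁
    field
      code     : Code O 1
      computes : ∀ α x → Eval α code (x ∷ []) (f α x)

  record Rec₂ (f : (O → ℕ → ℕ) → ℕ → ℕ → ℕ) : Set where
    constructor mkRec₂
    field
      code     : Code O 2
      computes : ∀ α x y → Eval α code (x ∷ y ∷ []) (f α x y)

  record Rec₃ (f : (O → ℕ → ℕ) → ℕ → ℕ → ℕ → ℕ) : Set where
    constructor mkRec₃
    field
      code     : Code O 3
      computes : ∀ α x y z → Eval α code (x ∷ y ∷ z ∷ []) (f α x y z)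

  open Recursive
  open Rec₁
  open Rec₂
  open Rec₃

  rec₁ : ∀ {F} → Recursive {1} F → Rec₁ (λ α x → F α (x ∷ []))
  rec₁ (mkRec e p) = mkRec₁ e λ α x → p α (x ∷ [])

  rec₂ : ∀ {F} → Recursive {2} F → Rec₂ (λ α x y → F α (x ∷ y ∷ []))
  rec₂ (mkRec e p) = mkRec₂ e λ α x y → p α (x ∷ y ∷ [])

  rec₃ : ∀ {F} → Recursive {3} F → Rec₃ (λ α x y z → F α (x ∷ y ∷ z ∷ []))
  rec₃ (mkRec e p) = mkRec₃ e λ α x y z → p α (x ∷ y ∷ z ∷ [])

  ext₁ : ∀ {f g} → (∀ α x → f α x ≡ g α x) → Rec₁ f → Rec₁ g
  ext₁ eq (mkRec₁ e p) = mkRec₁ e λ α x → subst (Eval α e _) (eq α x) (p α x)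

  var : ∀ {n} (i : Fin n) → Recursive (λ _ xs → lookup xs i)
  var i = mkRec (proj i) λ _ _ → e-proj

  #0 : ∀ {n} → Recursive {1 + n} (λ _ xs → lookup xs zero)
  #0 = var zero

  #1 : ∀ {n} → Recursive {2 + n} (λ _ xs → lookup xs (suc zero))
  #1 = var (suc zero)

  #2 : ∀ {n} → Recursive {3 + n} (λ _ xs → lookup xs (suc (suc zero)))
  #2 = var (suc (suc zero))

  infixl 5 _$₁_

  _$₁_ : ∀ {f n} {F : _ → Vec ℕ n → ℕ} → Rec₁ f → Recursive F →
         Recursive (λ α xs → f α (F α xs))
  f $₁ F = mkRec (comp (code f) (code F ∷ [])) λ α xs →
    e-comp (computes F α xs ∷ []) (computes f α _)

  app₂ : ∀ {f n} {F G : _ → Vec ℕ n → ℕ} → Rec₂ f → Recursive F → Recursive G →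
         Recursive (λ α xs → f α (F α xs) (G α xs))
  app₂ f F G = mkRec (comp (code f) (code F ∷ code G ∷ [])) λ α xs →
    e-comp (computes F α xs ∷ computes G α xs ∷ []) (computes f α _ _)

  suc-rec : Rec₁ (λ _ → suc)
  suc-rec = mkRec₁ suc λ _ _ → e-suc

  oracle-rec : ∀ o → Rec₁ (λ α → α o)
  oracle-rec o = mkRec₁ (oracle o) λ _ _ → e-oracle

  lit : ∀ {n} (k : ℕ) → Recursive {n} (λ _ _ → k)
  lit zero    = mkRec (comp zer []) λ _ _ → e-comp [] e-zer
  lit (suc k) = suc-rec $₁ lit k

  -- The recursion equations are hypotheses on a given `h`, which therefore need not unfold to the
  -- scheme.
  prec₁ : ∀ {g} (h : (O → ℕ → ℕ) → ℕ → ℕ) b → Rec₂ g →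
          (∀ α → b ≡ h α 0) → (∀ α k → g α k (h α k) ≡ h α (suc k)) → Rec₁ h
  prec₁ {g} h b G base step = mkRec₁ e eval
    where
    e : Code O 1
    e = prec (code (lit b)) (code G)
    eval : ∀ α k → Eval α e (k ∷ []) (h α k)
    eval α zero    = e-prec-0 (subst (Eval α _ []) (base α) (computes (lit b) α []))
    eval α (suc k) = e-prec-s (eval α k) (subst (Eval α _ _) (step α k) (computes G α _ _))

  prec₂ : ∀ {f g} (h : (O → ℕ → ℕ) → ℕ → ℕ → ℕ) → Rec₁ f → Rec₃ g →
          (∀ α x → f α x ≡ h α 0 x) → (∀ α k x → g α k (h α k x) x ≡ h α (suc k) x) → Rec₂ h
  prec₂ {f} {g} h F G base step = mkRec₂ e eval
    where
    e : Code O 2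
    e = prec (code F) (code G)
    eval : ∀ α k x → Eval α e (k ∷ x ∷ []) (h α k x)
    eval α zero    x = e-prec-0 (subst (Eval α _ _) (base α x) (computes F α x))
    eval α (suc k) x =
      e-prec-s (eval α k x) (subst (Eval α _ _) (step α k x) (computes G α _ _ _))

  private
    positive : ∀ {m} → m ≢ 0 → ∃[ v ] m ≡ suc v
    positive {zero}  0≢0 = ⊥-elim (0≢0 refl)
    positive {suc v} _   = v , refl

  mu₁ : ∀ {f} (g : (O → ℕ → ℕ) → ℕ → ℕ) → Rec₂ f → (∀ α x → f α (g α x) x ≡ 0) →
        (∀ α x z → z < g α x → f α z x ≢ 0) → Rec₁ g
  mu₁ {f} g F stop below = mkRec₁ (mu (code F)) λ α x → e-mu
    (λ z z<g → let v , eq = positive (below α x z z<g) in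
       v , subst (Eval α _ _) eq (computes F α z x))
    (subst (Eval α _ _) (stop α x) (computes F α (g α x) x))

  +-rec : Rec₂ (λ _ → _+_)
  +-rec = prec₂ (λ _ → _+_) (rec₁ #0) (rec₃ (suc-rec $₁ #1)) (λ _ _ → refl) (λ _ _ _ → refl)

  *-rec : Rec₂ (λ _ → _*_)
  *-rec = prec₂ (λ _ → _*_) (rec₁ (lit 0)) (rec₃ (app₂ +-rec #2 #1))
            (λ _ _ → refl) (λ _ _ _ → refl)

  pred-rec : Rec₁ (λ _ → pred)
  pred-rec = prec₁ (λ _ → pred) 0 (rec₂ #0) (λ _ → refl) (λ _ _ → refl)

  ∸-rec : Rec₂ (λ _ → _∸_)
  ∸-rec = rec₂ (app₂ flipped #1 #0)
    where
    -- The scheme recurs on the first argument, but iterating `pred` recurs on the subtrahend.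
    flipped : Rec₂ (λ _ n m → m ∸ n)
    flipped = prec₂ _ (rec₁ #0) (rec₃ (pred-rec $₁ #1))
                (λ _ _ → refl) (λ _ n m → pred[m∸n]≡m∸[1+n] m n)

  infixl 6 _⊕_ _⊖_
  infixl 7 _⊗_

  _⊕_ _⊖_ _⊗_ : ∀ {n} {F G : (O → ℕ → ℕ) → Vec ℕ n → ℕ} → Recursive F → Recursive G → Recursive _
  _⊕_ = app₂ +-rec
  _⊖_ = app₂ ∸-rec
  _⊗_ = app₂ *-rec

  2^-rec : Rec₁ (λ _ → 2 ^_)
  2^-rec = prec₁ _ 1 (rec₂ (lit 2 ⊗ #1)) (λ _ → refl) (λ _ _ → refl)

-- Pairing and binary strings

⌊2n/2⌋≡n : ∀ n → ⌊ 2 * n /2⌋ ≡ n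
⌊2n/2⌋≡n n = trans (cong (λ m → ⌊ n + m /2⌋) (+-identityʳ n)) (sym (n≡⌊n+n/2⌋ n))

⌊1+2n/2⌋≡n : ∀ n → ⌊ suc (2 * n) /2⌋ ≡ n
⌊1+2n/2⌋≡n n = trans (cong (λ m → ⌈ n + m /2⌉) (+-identityʳ n)) (sym (n≡⌈n+n/2⌉ n))

lastBit : ℕ → ℕ
lastBit n = n ∸ 2 * ⌊ n /2⌋

lastBit-2n : ∀ n → lastBit (2 * n) ≡ 0
lastBit-2n n = trans (cong (λ m → 2 * n ∸ 2 * m) (⌊2n/2⌋≡n n)) (n∸n≡0 (2 * n))

lastBit-1+2n : ∀ n → lastBit (suc (2 * n)) ≡ 1
lastBit-1+2n n = trans (cong (λ m → suc (2 * n) ∸ 2 * m) (⌊1+2n/2⌋≡n n)) (m+n∸n≡m 1 (2 * n))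

2*m≢1+2*n : ∀ m n → 2 * m ≢ suc (2 * n)
2*m≢1+2*n m n eq with () ← trans (sym (lastBit-2n m)) (trans (cong lastBit eq) (lastBit-1+2n n))

even⊎odd : ∀ n → (∃[ m ] n ≡ 2 * m) ⊎ (∃[ m ] n ≡ suc (2 * m))
even⊎odd zero = inj₁ (0 , refl)
even⊎odd (suc n) with even⊎odd n
... | inj₁ (m , refl) = inj₂ (m , refl)
... | inj₂ (m , refl) = inj₁ (suc m , sym (*-suc 2 m))

n<2^n : ∀ n → n < 2 ^ n
n<2^n zero    = s≤s z≤n
n<2^n (suc n) = +-mono-≤ (m^n>0 2 n) (≤-trans (n<2^n n) (≤-reflexive (sym (+-identityʳ _))))

-- pair a y = 2ᵃ (2y + 1) − 1; being affine in y is what linear universality needs.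
pair : ℕ → ℕ → ℕ
pair zero    y = 2 * y
pair (suc a) y = suc (2 * pair a y)

pair-affine : ∀ a y d → pair a (y + d) ≡ 2 ^ suc a * d + pair a y
pair-affine zero    y d = trans (*-distribˡ-+ 2 y d) (+-comm (2 * y) (2 * d))
pair-affine (suc a) y d =
  trans (cong (λ z → suc (2 * z)) (pair-affine a y d)) (lemma (2 ^ suc a) d (pair a y))
  where
  lemma : ∀ u v w → suc (2 * (u * v + w)) ≡ 2 * u * v + suc (2 * w)
  lemma = solve-∀

pair-monoʳ : ∀ a {y y′} → y ≤ y′ → pair a y ≤ pair a y′
pair-monoʳ zero    y≤y′ = *-monoʳ-≤ 2 y≤y′
pair-monoʳ (suc a) y≤y′ = s≤s (*-monoʳ-≤ 2 (pair-monoʳ a y≤y′))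

-- An even number ends the decomposition; 2m + 1 adds one to the first component found for m.
pair-surjective : ∀ n → ∃[ a ] ∃[ y ] pair a y ≡ n
pair-surjective = <-rec _ λ n rec → case n rec (even⊎odd n)
  where
  case : ∀ n → (∀ {m} → m < n → ∃[ a ] ∃[ y ] pair a y ≡ m) →
         (∃[ m ] n ≡ 2 * m) ⊎ (∃[ m ] n ≡ suc (2 * m)) → ∃[ a ] ∃[ y ] pair a y ≡ n
  case n rec (inj₁ (y , n≡2y)) = 0 , y , sym n≡2y
  case n rec (inj₂ (m , refl)) =
    let a , y , eq = rec (s≤s (m≤m+n m _)) in suc a , y , cong (λ z → suc (2 * z)) eq

pair-injective : ∀ a {y} a′ {y′} → pair a y ≡ pair a′ y′ → a ≡ a′ × y ≡ y′
pair-injective zero        zero          eq = refl , *-cancelˡ-≡ _ _ 2 eq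
pair-injective zero    {y} (suc a′) {y′} eq = ⊥-elim (2*m≢1+2*n y (pair a′ y′) eq)
pair-injective (suc a) {y} zero     {y′} eq = ⊥-elim (2*m≢1+2*n y′ (pair a y) (sym eq))
pair-injective (suc a)     (suc a′)      eq
  with refl , refl ← pair-injective a a′ (*-cancelˡ-≡ _ _ 2 (suc-injective eq)) = refl , refl

-- Read off from the proof of surjectivity; `fst-rec` finds the same number by a search.
fst : ℕ → ℕ
fst n = proj₁ (pair-surjective n)

snd : ℕ → ℕ
snd n = proj₁ (proj₂ (pair-surjective n))

pair-fst-snd : ∀ n → pair (fst n) (snd n) ≡ n
pair-fst-snd n = proj₂ (proj₂ (pair-surjective n))

fst-pair : ∀ a y → fst (pair a y) ≡ a
fst-pair a y = proj₁ (pair-injective (fst (pair a y)) a (pair-fst-snd (pair a y)))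

snd-pair : ∀ a y → snd (pair a y) ≡ y
snd-pair a y = proj₂ (pair-injective (fst (pair a y)) a (pair-fst-snd (pair a y)))

halve : ℕ → ℕ → ℕ
halve zero    n = n
halve (suc k) n = ⌊ halve k n /2⌋

-- `pair (suc a) y` is odd, and halving it gives `pair a y`, so each halving lowers the first
-- component by one.
halve-pair : ∀ k d y → halve k (pair (d + k) y) ≡ pair d y
halve-pair zero    d y = cong (λ a → pair a y) (+-identityʳ d)
halve-pair (suc k) d y =
  trans (cong (λ a → ⌊ halve k (pair a y) /2⌋) (+-suc d k))
  (trans (cong ⌊_/2⌋ (halve-pair k (suc d) y)) (⌊1+2n/2⌋≡n (pair d y)))

halve-odd : ∀ {k a} y → k < a → lastBit (halve k (pair a y)) ≡ 1
halve-odd {k} y k<a with d , refl ← m≤n⇒∃[o]m+o≡n k<a =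
  trans (cong (λ a → lastBit (halve k (pair (suc a) y))) (+-comm k d))
  (trans (cong lastBit (halve-pair k (suc d) y)) (lastBit-1+2n (pair d y)))

halve-fst : ∀ n → halve (fst n) n ≡ 2 * snd n
halve-fst n =
  trans (cong (halve (fst n)) (sym (pair-fst-snd n))) (halve-pair (fst n) 0 (snd n))

-- Vanishes only for equal arguments, which turns equality into a test for `mu`.
distance : ℕ → ℕ → ℕ
distance m n = (m ∸ n) + (n ∸ m)

distance-refl : ∀ n → distance n n ≡ 0
distance-refl n = cong₂ _+_ (n∸n≡0 n) (n∸n≡0 n)

distance≡0⇒≡ : ∀ m n → distance m n ≡ 0 → m ≡ n
distance≡0⇒≡ m n eq = ≤-antisym (m∸n≡0⇒m≤n (m+n≡0⇒m≡0 (m ∸ n) eq))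
                                (m∸n≡0⇒m≤n (m+n≡0⇒n≡0 (m ∸ n) eq))

-- Links the arithmetical indicator of equality, which is recursive, to the Boolean one that defines
-- `graph`.
1∸distance : ∀ m n → 1 ∸ distance m n ≡ (if m ≡ᵇ n then 1 else 0)
1∸distance zero    zero    = refl
1∸distance zero    (suc n) = 0∸n≡0 n
1∸distance (suc m) zero    = 0∸n≡0 (m + 0)
1∸distance (suc m) (suc n) = 1∸distance m n

module _ {O : Set} where

  half-rec : Rec₁ {O} (λ _ → ⌊_/2⌋)
  -- ⌊(n+1)/2⌋ = ⌈n/2⌉ is n minus the preceding value ⌊n/2⌋.
  half-rec = prec₁ _ 0 (rec₂ (#0 ⊖ #1)) (λ _ → refl)
    (λ _ n → trans (cong (_∸ ⌊ n /2⌋) (sym (⌊n/2⌋+⌈n/2⌉≡n n))) (m+n∸m≡n ⌊ n /2⌋ ⌈ n /2⌉))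

  lastBit-rec : Rec₁ {O} (λ _ → lastBit)
  lastBit-rec = rec₁ (#0 ⊖ lit 2 ⊗ (half-rec $₁ #0))

  pair-rec : Rec₂ {O} (λ _ → pair)
  pair-rec = prec₂ (λ _ → pair) (rec₁ (lit 2 ⊗ #0)) (rec₃ (suc-rec $₁ (lit 2 ⊗ #1)))
    (λ _ _ → refl) (λ _ _ _ → refl)

  halve-rec : Rec₂ {O} (λ _ → halve)
  halve-rec = prec₂ (λ _ → halve) (rec₁ #0) (rec₃ (half-rec $₁ #1))
    (λ _ _ → refl) (λ _ _ _ → refl)

  -- fst n is the least k for which ⌊ n / 2ᵏ ⌋ is even.
  fst-rec : Rec₁ {O} (λ _ → fst)
  fst-rec = mu₁ (λ _ → fst) (rec₂ (lastBit-rec $₁ app₂ halve-rec #0 #1))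
    (λ _ n → trans (cong lastBit (halve-fst n)) (lastBit-2n (snd n)))
    (λ _ n k k<a eq → 0≢1+n (trans (sym eq)
      (trans (cong (λ m → lastBit (halve k m)) (sym (pair-fst-snd n))) (halve-odd (snd n) k<a))))

  snd-rec : Rec₁ {O} (λ _ → snd)
  snd-rec = ext₁ (λ _ n → trans (cong ⌊_/2⌋ (halve-fst n)) (⌊2n/2⌋≡n (snd n)))
    (rec₁ (half-rec $₁ app₂ halve-rec (fst-rec $₁ #0) #0))

  distance-rec : Rec₂ {O} (λ _ → distance)
  distance-rec = rec₂ ((#0 ⊖ #1) ⊕ (#1 ⊖ #0))

encode-injective : ∀ σ τ → encode σ ≡ encode τ → σ ≡ τ
encode-injective []          []          eq = refl
encode-injective []          (false ∷ τ) ()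
encode-injective []          (true  ∷ τ) ()
encode-injective (false ∷ σ) []          ()
encode-injective (true  ∷ σ) []          ()
encode-injective (false ∷ σ) (false ∷ τ) eq =
  cong (false ∷_) (encode-injective σ τ (*-cancelˡ-≡ _ _ 2 (suc-injective eq)))
encode-injective (true  ∷ σ) (true  ∷ τ) eq =
  cong (true ∷_) (encode-injective σ τ (*-cancelˡ-≡ _ _ 2 (suc-injective (suc-injective eq))))
encode-injective (false ∷ σ) (true  ∷ τ) eq = ⊥-elim (2*m≢1+2*n (encode σ) (encode τ) (suc-injective eq))
encode-injective (true  ∷ σ) (false ∷ τ) eq = ⊥-elim (2*m≢1+2*n (encode τ) (encode σ) (sym (suc-injective eq)))

encode-surjective : ∀ n → ∃[ σ ] encode σ ≡ n
encode-surjective = <-rec _ step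
  where
  step : ∀ n → (∀ {m} → m < n → ∃[ σ ] encode σ ≡ m) → ∃[ σ ] encode σ ≡ n
  step zero    rec = [] , refl
  step (suc n) rec with even⊎odd n
  ... | inj₁ (m , refl) =
    let σ , eq = rec (s≤s (m≤m+n m _)) in false ∷ σ , cong (λ z → suc (2 * z)) eq
  ... | inj₂ (m , refl) =
    let σ , eq = rec (s≤s (m≤n⇒m≤1+n (m≤m+n m _))) in true ∷ σ , cong (λ z → suc (suc (2 * z))) eq

length≤encode : ∀ σ → length σ ≤ encode σ
length≤encode []          = z≤n
length≤encode (false ∷ σ) = s≤s (≤-trans (length≤encode σ) (m≤m+n _ _))
length≤encode (true  ∷ σ) = s≤s (m≤n⇒m≤1+n (≤-trans (length≤encode σ) (m≤m+n _ _)))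

-- The summand 2 makes the induction work: prepending a bit at most doubles `2 + encode σ`.
encode<2^ : ∀ σ → 2 + encode σ ≤ 2 ^ suc (length σ)
encode<2^ []          = ≤-refl
encode<2^ (b ∷ σ)     = ≤-trans (lemma b) (*-monoʳ-≤ 2 (encode<2^ σ))
  where
  lemma : ∀ b → 2 + encode (b ∷ σ) ≤ 2 * (2 + encode σ)
  lemma false = ≤-trans (n≤1+n _) (≤-reflexive (sym (*-distribˡ-+ 2 2 (encode σ))))
  lemma true  = ≤-reflexive (sym (*-distribˡ-+ 2 2 (encode σ)))

-- Each bit of ρ doubles the contribution of the rest. For fixed ρ the code is affine in that of τ,
-- with a slope that `program` takes from its input.
encode-++ : ∀ ρ τ → encode (ρ ++ τ) ≡ encode ρ + 2 ^ length ρ * encode τ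
encode-++ []          τ = sym (+-identityʳ _)
encode-++ (false ∷ ρ) τ = trans (cong (λ z → 1 + 2 * z) (encode-++ ρ τ)) (lemma (encode ρ) (2 ^ length ρ) (encode τ))
  where
  lemma : ∀ r p t → 1 + 2 * (r + p * t) ≡ 1 + 2 * r + 2 * p * t
  lemma = solve-∀
encode-++ (true ∷ ρ)  τ = trans (cong (λ z → 2 + 2 * z) (encode-++ ρ τ)) (lemma (encode ρ) (2 ^ length ρ) (encode τ))
  where
  lemma : ∀ r p t → 2 + 2 * (r + p * t) ≡ 2 + 2 * r + 2 * p * t
  lemma = solve-∀

bit : Bool → ℕ
bit b = if b then 1 else 0

encode-∷ : ∀ b σ → encode (b ∷ σ) ≡ suc (bit b + 2 * encode σ)
encode-∷ false σ = refl
encode-∷ true  σ = refl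

-- `encode` recurs from the front, whereas a computation from an oracle extends the segment at its
-- end.
encode-↾ : ∀ X n → encode (X ↾ suc n) ≡ encode (X ↾ n) + 2 ^ n * suc (bit (X n))
encode-↾ X n = begin
  encode (X ↾ suc n)                                 ≡⟨ cong encode (sym (applyUpTo-∷ʳ X n)) ⟩
  encode ((X ↾ n) ∷ʳ X n)                            ≡⟨ encode-++ (X ↾ n) (X n ∷ []) ⟩
  encode (X ↾ n) + 2 ^ length (X ↾ n) * encode (X n ∷ [])
    ≡⟨ cong₂ (λ l e → encode (X ↾ n) + 2 ^ l * e) (length-applyUpTo X n)
         (trans (encode-∷ (X n) []) (cong suc (+-identityʳ _))) ⟩
  encode (X ↾ n) + 2 ^ n * suc (bit (X n))           ∎
  where open ≡-Reasoning

-- On the code of a nonempty string, decrementing leaves the first bit as parity, and halving then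
-- leaves the code of the tail.
drop# : ℕ → ℕ → ℕ
drop# zero    e = e
drop# (suc i) e = ⌊ pred (drop# i e) /2⌋

lookup# : ℕ → ℕ → ℕ
lookup# i e = lastBit (pred (drop# i e))

drop#-suc : ∀ i e → drop# (suc i) e ≡ drop# i ⌊ pred e /2⌋
drop#-suc zero    e = refl
drop#-suc (suc i) e = cong (λ z → ⌊ pred z /2⌋) (drop#-suc i e)

lookup#-encode-∷ : ∀ b σ → lookup# 0 (encode (b ∷ σ)) ≡ bit b
lookup#-encode-∷ false σ = lastBit-2n (encode σ)
lookup#-encode-∷ true  σ = lastBit-1+2n (encode σ)

drop#-encode-∷ : ∀ b σ → drop# 1 (encode (b ∷ σ)) ≡ encode σ
drop#-encode-∷ false σ = ⌊2n/2⌋≡n (encode σ)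
drop#-encode-∷ true  σ = ⌊1+2n/2⌋≡n (encode σ)

lookup#-↾ : ∀ X {i n} → i < n → lookup# i (encode (X ↾ n)) ≡ bit (X i)
lookup#-↾ X {zero}  (s≤s _)   = lookup#-encode-∷ (X 0) _
lookup#-↾ X {suc i} (s≤s i<n) = trans
  (cong (λ z → lastBit (pred z)) (trans (drop#-suc i _) (cong (drop# i) (drop#-encode-∷ (X 0) _))))
  (lookup#-↾ (λ n → X (suc n)) i<n)

lookup#-rec : ∀ {O} → Rec₂ {O} (λ _ → lookup#)
lookup#-rec = rec₂ (lastBit-rec $₁ (pred-rec $₁ app₂ drop#-rec #0 #1))
  where
  drop#-rec : Rec₂ (λ _ → drop#)
  drop#-rec = prec₂ (λ _ → drop#) (rec₁ #0) (rec₃ (half-rec $₁ (pred-rec $₁ #1)))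
    (λ _ _ → refl) (λ _ _ _ → refl)

unary : ℕ → String
unary x = replicate x false ++ true ∷ []

-- A leading `false` acts on codes as `suc` acts in the first component of `pair`, and the final
-- `true` has code 2, which is `pair 0 1`.
encode-unary : ∀ x → encode (unary x) ≡ pair x 1
encode-unary zero    = refl
encode-unary (suc x) = cong (λ z → suc (2 * z)) (encode-unary x)

unary-prefixFree : ∀ x y → Prefix _≡_ (unary x) (unary y) → x ≡ y
unary-prefixFree zero    zero    _       = refl
unary-prefixFree (suc x) (suc y) (_ ∷ p) = cong suc (unary-prefixFree x y p)
unary-prefixFree zero    (suc y) (() ∷ _)
unary-prefixFree (suc x) zero    (() ∷ _)

-- Rationals, naturals and reals

fromℚᵘ-mono-≤ : ∀ p q → p ℚᵘ.≤ q → fromℚᵘ p ℚ.≤ fromℚᵘ q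
fromℚᵘ-mono-≤ p q p≤q = ℚₚ.toℚᵘ-cancel-≤
  (ℚᵘₚ.≤-respʳ-≃ (ℚᵘₚ.≃-sym (ℚₚ.toℚᵘ-fromℚᵘ q)) (ℚᵘₚ.≤-respˡ-≃ (ℚᵘₚ.≃-sym (ℚₚ.toℚᵘ-fromℚᵘ p)) p≤q))

fromℚᵘ-cancel-≤ : ∀ p q → fromℚᵘ p ℚ.≤ fromℚᵘ q → p ℚᵘ.≤ q
fromℚᵘ-cancel-≤ p q p≤q =
  ℚᵘₚ.≤-respʳ-≃ (ℚₚ.toℚᵘ-fromℚᵘ q) (ℚᵘₚ.≤-respˡ-≃ (ℚₚ.toℚᵘ-fromℚᵘ p) (ℚₚ.toℚᵘ-mono-≤ p≤q))

fromℚᵘ-+ : ∀ p q → fromℚᵘ (p ℚᵘ.+ q) ≡ fromℚᵘ p ℚ.+ fromℚᵘ q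
fromℚᵘ-+ p q = ℚₚ.toℚᵘ-injective (ℚᵘₚ.≃-trans (ℚₚ.toℚᵘ-fromℚᵘ (p ℚᵘ.+ q))
  (ℚᵘₚ.≃-sym (ℚᵘₚ.≃-trans (ℚₚ.toℚᵘ-homo-+ (fromℚᵘ p) (fromℚᵘ q))
    (ℚᵘₚ.+-cong (ℚₚ.toℚᵘ-fromℚᵘ p) (ℚₚ.toℚᵘ-fromℚᵘ q)))))

<⇒≱ℚ : ∀ {p q} → p ℚ.< q → ¬ (q ℚ.≤ p)
<⇒≱ℚ p<q q≤p = ℚₚ.<-irrefl refl (ℚₚ.<-≤-trans p<q q≤p)

ι : ℕ → ℚ
ι n = (+ n) ℚ./ 1

ι-mono-≤ : ∀ {m n} → m ≤ n → ι m ℚ.≤ ι n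
ι-mono-≤ {m} {n} m≤n = fromℚᵘ-mono-≤ (mkℚᵘ (+ m) 0) (mkℚᵘ (+ n) 0) (ℚᵘ.*≤* (ℤₚ.*-monoʳ-≤-nonNeg (+ 1) (ℤ.+≤+ m≤n)))

ι-cancel-≤ : ∀ {m n} → ι m ℚ.≤ ι n → m ≤ n
ι-cancel-≤ {m} {n} ιm≤ιn with fromℚᵘ-cancel-≤ (mkℚᵘ (+ m) 0) (mkℚᵘ (+ n) 0) ιm≤ιn
... | ℚᵘ.*≤* m≤n = ℤₚ.drop‿+≤+ (subst₂ ℤ._≤_ (ℤₚ.*-identityʳ (+ m)) (ℤₚ.*-identityʳ (+ n)) m≤n)

ι-cancel-< : ∀ {m n} → ι m ℚ.< ι n → m < n
ι-cancel-< {m} {n} ιm<ιn = ≰⇒> λ n≤m → <⇒≱ℚ ιm<ιn (ι-mono-≤ n≤m)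

ι-+ : ∀ m n → ι (m + n) ≡ ι m ℚ.+ ι n
ι-+ m n = trans
  (cong (ℚ._/ 1) {x = + (m + n)} (sym (cong₂ ℤ._+_ (ℤₚ.*-identityʳ (+ m)) (ℤₚ.*-identityʳ (+ n)))))
  (fromℚᵘ-+ (mkℚᵘ (+ m) 0) (mkℚᵘ (+ n) 0))

ι<ι-suc : ∀ n → ι n ℚ.< ι (suc n)
ι<ι-suc n = ℚₚ.≰⇒> λ le → 1+n≰n (ι-cancel-≤ {suc n} {n} le)

-- The absolute value of the numerator is large enough, since the denominator is at least 1.
archimedean : ∀ q → ∃[ n ] q ℚ.≤ ι n
archimedean q@record{} = ℤ.∣ ℚ.↥ q ∣ , ℚₚ.≤-trans (ℚₚ.≤-reflexive (sym (ℚₚ.fromℚᵘ-toℚᵘ q)))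
  (fromℚᵘ-mono-≤ (toℚᵘ q) (mkℚᵘ (+ ℤ.∣ ℚ.↥ q ∣) 0) (ℚᵘ.*≤* (ineq (ℚ.↥ q) (ℚ.denominator-1 q))))
  where
  ineq : ∀ i d → i ℤ.* + 1 ℤ.≤ + ℤ.∣ i ∣ ℤ.* + suc d
  ineq (+ n)      d = ℤₚ.*-monoˡ-≤-nonNeg (+ n) (ℤ.+≤+ (s≤s z≤n))
  ineq (-[1+ n ]) d = ℤ.-≤+

-- The form in which `Computable` presents rational approximations.
ratio : ℕ → ℕ → ℕ → ℚ
ratio s t d = (s ℤ.⊖ t) ℚ./ suc d

ratio≤ι : ∀ s t d → ratio s t d ℚ.≤ ι s
ratio≤ι s t d = fromℚᵘ-mono-≤ (mkℚᵘ (s ℤ.⊖ t) d) (mkℚᵘ (+ s) 0) (ℚᵘ.*≤* (ℤₚ.≤-trans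
  (ℤₚ.*-monoʳ-≤-nonNeg (+ 1) (ℤₚ.m⊖n≤m s t))
  (ℤₚ.*-monoˡ-≤-nonNeg (+ s) (ℤ.+≤+ (s≤s z≤n)))))

-- Clearing the denominator and the subtraction leaves an inequality between naturals, which a
-- recursive test can decide; `ι≤ratio⁻¹` is the converse.
ι≤ratio : ∀ {G s t d} → t + G * suc d ≤ s → ι G ℚ.≤ ratio s t d
ι≤ratio {G} {s} {t} {d} le = fromℚᵘ-mono-≤ (mkℚᵘ (+ G) 0) (mkℚᵘ (s ℤ.⊖ t) d) (ℚᵘ.*≤* (begin
  + G ℤ.* + suc d     ≡⟨ ℤₚ.pos-* G (suc d) ⟨
  + (G * suc d)       ≤⟨ ℤ.+≤+ (m+n≤o⇒n≤o∸m t le) ⟩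
  + (s ∸ t)           ≡⟨ ℤₚ.⊖-≥ (m+n≤o⇒m≤o t le) ⟨
  s ℤ.⊖ t             ≡⟨ ℤₚ.*-identityʳ (s ℤ.⊖ t) ⟨
  (s ℤ.⊖ t) ℤ.* + 1   ∎))
  where
  open ℤₚ.≤-Reasoning
  m+n≤o⇒n≤o∸m : ∀ m {n o} → m + n ≤ o → n ≤ o ∸ m
  m+n≤o⇒n≤o∸m m {n} le = m+n≤o⇒m≤o∸n n (≤-trans (≤-reflexive (+-comm n m)) le)

ι≤ratio⁻¹ : ∀ {G s t d} → ι G ℚ.≤ ratio s t d → t + G * suc d ≤ s
ι≤ratio⁻¹ {G} {s} {t} {d} le with fromℚᵘ-cancel-≤ (mkℚᵘ (+ G) 0) (mkℚᵘ (s ℤ.⊖ t) d) le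
... | ℚᵘ.*≤* leᵘ = ℤₚ.drop‿+≤+ (begin
  + (t + G * suc d)           ≡⟨ cong (λ n → + t ℤ.+ n) (ℤₚ.pos-* G (suc d)) ⟩
  + t ℤ.+ + G ℤ.* + suc d     ≤⟨ ℤₚ.+-monoʳ-≤ (+ t) leᵘ ⟩
  + t ℤ.+ (s ℤ.⊖ t) ℤ.* + 1   ≡⟨ cong (λ i → + t ℤ.+ i) (ℤₚ.*-identityʳ (s ℤ.⊖ t)) ⟩
  + t ℤ.+ (s ℤ.⊖ t)           ≡⟨ ℤₚ.distribʳ-⊖-+-pos t s t ⟩
  (t + s) ℤ.⊖ t               ≡⟨ cong ((t + s) ℤ.⊖_) (+-identityʳ t) ⟨
  (t + s) ℤ.⊖ (t + 0)         ≡⟨ ℤₚ.+-cancelˡ-⊖ t s 0 ⟩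
  + s                         ∎)
  where open ℤₚ.≤-Reasoning

p+q-q≡p : ∀ p q → p ℚ.+ q ℚ.- q ≡ p
p+q-q≡p = solve 2 (λ p q → p :+ q :- q := p) refl
  where open +-*-Solver

p-q+q≡p : ∀ p q → p ℚ.- q ℚ.+ q ≡ p
p-q+q≡p = solve 2 (λ p q → p :- q :+ q := p) refl
  where open +-*-Solver

+-cancelʳ-≤ℚ : ∀ {p q} r → p ℚ.+ r ℚ.≤ q ℚ.+ r → p ℚ.≤ q
+-cancelʳ-≤ℚ {p} {q} r le = subst₂ ℚ._≤_ (p+q-q≡p p r) (p+q-q≡p q r) (ℚₚ.+-monoˡ-≤ (ℚ.- r) le)

+-cancelʳ-<ℚ : ∀ {p q} r → p ℚ.+ r ℚ.< q ℚ.+ r → p ℚ.< q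
+-cancelʳ-<ℚ {p} {q} r lt = ℚₚ.≰⇒> λ q≤p → <⇒≱ℚ lt (ℚₚ.+-monoˡ-≤ r q≤p)

p≤p+q : ∀ p {q} → 0ℚ ℚ.≤ q → p ℚ.≤ p ℚ.+ q
p≤p+q p {q} 0≤q = subst (ℚ._≤ p ℚ.+ q) (ℚₚ.+-identityʳ p) (ℚₚ.+-monoʳ-≤ p 0≤q)

fromℚ-mono : ∀ {p q} → p ℚ.≤ q → fromℚ p ≤ℝ fromℚ q
fromℚ-mono {p} {q} p≤q k = ℚₚ.≤-trans p≤q (p≤p+q q (ℚₚ.+-mono-≤ (2⁻-nonNeg k) (2⁻-nonNeg k)))

fromℕ-mono-≤ : ∀ {m n} → m ≤ n → fromℕ m ≤ℝ fromℕ n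
fromℕ-mono-≤ m≤n = fromℚ-mono (ι-mono-≤ m≤n)

fromℕ-mono-< : ∀ {m n} → m < n → fromℕ m <ℝ fromℕ n
-- At index 2 the margin is 1/4 + 1/4, less than the distance between distinct naturals.
fromℕ-mono-< {m} {n} m<n = 2 , (begin-strict
  ι m ℚ.+ (2⁻ 2 ℚ.+ 2⁻ 2)   <⟨ ℚₚ.+-monoʳ-< (ι m) (ι-½<1) ⟩
  ι m ℚ.+ ι 1               ≡⟨ ι-+ m 1 ⟨
  ι (m + 1)                 ≡⟨ cong ι (+-comm m 1) ⟩
  ι (suc m)                 ≤⟨ ι-mono-≤ m<n ⟩
  ι n                       ∎)
  where
  open ℚₚ.≤-Reasoning
  ι-½<1 : 2⁻ 2 ℚ.+ 2⁻ 2 ℚ.< ι 1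
  ι-½<1 = ℚ.*<* (ℤ.+<+ (s≤s (s≤s z≤n)))

-- Both relations allow the same margin at index k, so it cancels at the index that witnesses the
-- strict one.
<ℝ-≤ℝ⇒< : ∀ {x p q} → fromℚ p <ℝ x → x ≤ℝ fromℚ q → p ℚ.< q
<ℝ-≤ℝ⇒< {x} {p} {q} (k , p<x) x≤q = +-cancelʳ-<ℚ (2⁻ k ℚ.+ 2⁻ k) (ℚₚ.<-≤-trans p<x (x≤q k))

fromRec₂ : ∀ {f} → Rec₂ {⊥} (λ _ → f) → Recursive₂ f
fromRec₂ F = Rec₂.code F , Rec₂.computes F ⊥-elim

toRec₂ : ∀ {O f} → Recursive₂ f → Rec₂ {O} (λ _ → f)
toRec₂ (e , eval) = mkRec₂ (relativize e) λ _ m n → relativize-Eval e (eval m n)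

fromℕ-computable : ∀ {f} → Rec₁ {⊥} (λ _ → f) → Computable (λ n → fromℕ (f n))
fromℕ-computable {f} F =
  (λ n _ → f n) , (λ _ _ → 0) , (λ _ _ → 0) ,
  fromRec₂ (rec₂ (F $₁ #0)) , fromRec₂ (rec₂ (lit 0)) , fromRec₂ (rec₂ (lit 0)) ,
  λ n k → fromℚ-mono (minus (ι (f n)) (2⁻-nonNeg k)) , fromℚ-mono (p≤p+q (ι (f n)) (2⁻-nonNeg k))
  where
  minus : ∀ p {e} → 0ℚ ℚ.≤ e → p ℚ.- e ℚ.≤ p
  minus p {e} 0≤e = subst (p ℚ.- e ℚ.≤_) (ℚₚ.+-identityʳ p) (ℚₚ.+-monoʳ-≤ p (ℚₚ.neg-antimono-≤ 0≤e))

<ℝ-bound : ∀ B → ∃[ b ] (∀ y → ι b ℚ.≤ approx y 0 → B <ℝ y)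
<ℝ-bound B with archimedean (approx B 0)
-- The margin at index 0 is 2; one more makes the inequality strict.
... | j , B≤j = 3 + j , λ y b≤y → 0 , ℚₚ.≤-<-trans (ℚₚ.+-monoˡ-≤ (ι 2) B≤j)
  (ℚₚ.<-≤-trans (subst (ℚ._< ι (3 + j)) (trans (cong ι (+-comm 2 j)) (ι-+ j 2)) (ι<ι-suc (2 + j))) b≤y)

fromℕ-order : ∀ {f} → Rec₁ {⊥} (λ _ → f) → (∀ m n → m ≤ n → f m ≤ f n) →
              (∀ b → ∃[ n ] b ≤ f n) → IsOrder (λ n → fromℕ (f n))
fromℕ-order {f} F mono unb =
  fromℕ-computable F , (λ m n m≤n → fromℕ-mono-≤ (mono m n m≤n)) ,
  λ B → let b , B< = <ℝ-bound B ; n , b≤fn = unb b in n , B< (fromℕ (f n)) (ι-mono-≤ b≤fn)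

fromℕ-subIdentical : ∀ {f : ℕ → ℕ} → (∀ b → ∃[ N ] (∀ n → N ≤ n → b + f n ≤ n)) →
                     SubIdentical (λ n → fromℕ (f n))
fromℕ-subIdentical {f} gap B =
  let b , B< = <ℝ-bound B ; N , b+f≤ = gap b in
  N , λ n N≤n → B< (fromℕ n -ℝ fromℕ (f n)) (+-cancelʳ-≤ℚ {ι b} {ι n ℚ.- ι (f n)} (ι (f n)) (begin
    ι b ℚ.+ ι (f n)                      ≡⟨ ι-+ b (f n) ⟨
    ι (b + f n)                          ≤⟨ ι-mono-≤ {b + f n} {n} (b+f≤ n N≤n) ⟩
    ι n                                  ≡⟨ p-q+q≡p (ι n) (ι (f n)) ⟨
    ι n ℚ.- ι (f n) ℚ.+ ι (f n)          ∎))
  where open ℚₚ.≤-Reasoning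

fromℕ-∸-≤ : ∀ {m c k} → m ≤ k + c → fromℕ m -ℝ fromℕ c ≤ℝ fromℕ k
fromℕ-∸-≤ {m} {c} {k} m≤k+c = fromℚ-mono {ι m ℚ.- ι c} {ι k} (begin
  ι m ℚ.- ι c             ≤⟨ ℚₚ.+-monoˡ-≤ (ℚ.- ι c) (ι-mono-≤ {m} {k + c} m≤k+c) ⟩
  ι (k + c) ℚ.- ι c       ≡⟨ cong (ℚ._- ι c) (ι-+ k c) ⟩
  ι k ℚ.+ ι c ℚ.- ι c     ≡⟨ p+q-q≡p (ι k) (ι c) ⟩
  ι k                     ∎)
  where open ℚₚ.≤-Reasoning

-- The zeroth approximation s/(d+1) − t/(d+1) of p n is at most s, and is off by at most 1.
computable-bound : ∀ {p} → Computable p →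
  ∃[ b ] Rec₁ {⊥} (λ _ → b) × (∀ n x → fromℕ x <ℝ p n → x ≤ b n)
computable-bound {p} (s , t , d , S , T , D , near) =
  (λ n → s n 0) , rec₁ (app₂ (toRec₂ S) #0 (lit 0)) , λ n x x<p →
    s≤s⁻¹ (ι-cancel-< {x} {suc (s n 0)} (ℚₚ.<-≤-trans
      (<ℝ-≤ℝ⇒< {p n} {ι x} {ratio (s n 0) (t n 0) (d n 0) ℚ.+ ι 1} x<p (proj₂ (near n 0)))
      (ℚₚ.≤-trans (ℚₚ.+-monoˡ-≤ (ι 1) (ratio≤ι (s n 0) (t n 0) (d n 0)))
        (ℚₚ.≤-reflexive (trans (sym (ι-+ (s n 0) 1)) (cong ι (+-comm (s n 0) 1)))))))

-- Unbounded search and the growth of order functions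

least : (P : ℕ → ℕ) → ∀ z → P z ≡ 0 → ∃[ z ] P z ≡ 0 × (∀ y → y < z → P y ≢ 0)
least P zero    P0 = 0 , P0 , λ _ ()
least P (suc z) Pz with P 0 in P0
... | zero  = 0 , P0 , λ _ ()
... | suc v with least (λ y → P (suc y)) z Pz
... | w , Pw , below = suc w , Pw , λ
  { zero    _         P0≡0 → 0≢1+n (trans (sym P0≡0) P0)
  ; (suc y) (s≤s y<w) Py≡0 → below y y<w Py≡0 }

-- The given zeros need not depend recursively on n. Passing to the least zero makes the choice
-- recursive.
search : ∀ {T} → Rec₂ {⊥} (λ _ → T) → (∀ n → ∃[ z ] T z n ≡ 0) →
         ∃[ m ] Rec₁ {⊥} (λ _ → m) × (∀ n → T (m n) n ≡ 0)
search {T} Tᵣ exists =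
  (λ n → proj₁ (first n)) ,
  mu₁ _ Tᵣ (λ _ n → proj₁ (proj₂ (first n))) (λ _ n → proj₂ (proj₂ (first n))) ,
  λ n → proj₁ (proj₂ (first n))
  where
  first : ∀ n → ∃[ z ] T z n ≡ 0 × (∀ y → y < z → T y n ≢ 0)
  first n = least (λ z → T z n) (proj₁ (exists n)) (proj₂ (exists n))

-- Gives recursive nondecreasing bounds for the values of an arbitrary recursive function.
partialSum : (ℕ → ℕ) → ℕ → ℕ
partialSum a zero    = 0
partialSum a (suc n) = partialSum a n + a n

partialSum-rec : ∀ {O a} → Rec₁ {O} (λ _ → a) → Rec₁ {O} (λ _ → partialSum a)
partialSum-rec A = prec₁ _ 0 (rec₂ (#1 ⊕ (A $₁ #0))) (λ _ → refl) (λ _ _ → refl)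

partialSum-mono : ∀ a {m n} → m ≤ n → partialSum a m ≤ partialSum a n
partialSum-mono a m≤n = go (≤⇒≤′ m≤n)
  where
  go : ∀ {m n} → m ≤′ n → partialSum a m ≤ partialSum a n
  go ≤′-refl            = ≤-refl
  go (≤′-step {n} m≤′n) = ≤-trans (go m≤′n) (m≤m+n (partialSum a n) (a n))

term≤partialSum : ∀ a {i n} → i < n → a i ≤ partialSum a n
term≤partialSum a {i} i<n = ≤-trans (m≤n+m (a i) (partialSum a i)) (partialSum-mono a i<n)

-- The constant 5 absorbs the errors of the approximations.
order-modulus : ∀ {f} → IsOrder f → ∀ {G : ℕ → ℕ} → Rec₁ {⊥} (λ _ → G) →
  ∃[ m ] Rec₁ {⊥} (λ _ → m) ×
  (∀ n N c k → m n ≤ N → f N -ℝ fromℕ c ≤ℝ fromℕ k → G n ≤ k + c + 5)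
order-modulus {f} ((s , t , d , S , T , D , near) , mono , unbounded) {G} Gᵣ =
  proj₁ found , proj₁ (proj₂ found) , λ n N c k m≤N f≤k →
    bound n N c k (m∸n≡0⇒m≤n (proj₂ (proj₂ found) n)) m≤N f≤k
  where
  open ℚₚ.≤-Reasoning
  r : ℕ → ℚ
  r M = ratio (s M 0) (t M 0) (d M 0)
  test : ℕ → ℕ → ℕ
  test M n = t M 0 + G n * suc (d M 0) ∸ s M 0
  passes : ∀ n → ∃[ M ] test M n ≡ 0
  -- The additional 1 pays for the error of the approximation `r M`.
  passes n with unbounded (fromℕ (G n + 1))
  ... | M , G<f = M , m≤n⇒m∸n≡0 (ι≤ratio⁻¹ {G n} {s M 0} {t M 0} {d M 0}
    (ℚₚ.<⇒≤ (+-cancelʳ-<ℚ {ι (G n)} {r M} (ι 1) (subst (ℚ._< r M ℚ.+ ι 1) (ι-+ (G n) 1)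
      (<ℝ-≤ℝ⇒< {f M} {ι (G n + 1)} {r M ℚ.+ ι 1} G<f (proj₂ (near M 0)))))))
  found : ∃[ m ] Rec₁ {⊥} (λ _ → m) × (∀ n → test (m n) n ≡ 0)
  found = search
    (rec₂ (app₂ (toRec₂ T) #0 (lit 0) ⊕ (Gᵣ $₁ #1) ⊗ (suc-rec $₁ app₂ (toRec₂ D) #0 (lit 0))
           ⊖ app₂ (toRec₂ S) #0 (lit 0)))
    passes
  bound : ∀ n N c k → ∀ {M} → t M 0 + G n * suc (d M 0) ≤ s M 0 → M ≤ N →
          f N -ℝ fromℕ c ≤ℝ fromℕ k → G n ≤ k + c + 5
  -- `-ℝ` shifts indices, so `f≤k` at index 0 concerns `approx (f N) 1`. The error of `r M` costs 1,
  -- the two comparisons at index 1 cost 1 each, and `f≤k` costs 2.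
  bound n N c k {M} G≤r M≤N f≤k = ι-cancel-≤ {G n} {k + c + 5} (begin
    ι (G n)                                       ≤⟨ ι≤ratio {G n} {s M 0} {t M 0} {d M 0} G≤r ⟩
    r M                                           ≡⟨ p-q+q≡p (r M) (ι 1) ⟨
    r M ℚ.- ι 1 ℚ.+ ι 1                           ≤⟨ ℚₚ.+-monoˡ-≤ (ι 1) (proj₁ (near M 0) 1) ⟩
    approx (f M) 1 ℚ.+ ι 1 ℚ.+ ι 1                ≤⟨ ℚₚ.+-monoˡ-≤ (ι 1) (ℚₚ.+-monoˡ-≤ (ι 1) (mono M N M≤N 1)) ⟩
    approx (f N) 1 ℚ.+ ι 1 ℚ.+ ι 1 ℚ.+ ι 1        ≡⟨ swap (approx (f N) 1) (ι c) (ι 1) ⟩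
    approx (f N) 1 ℚ.- ι c ℚ.+ (ι c ℚ.+ (ι 1 ℚ.+ ι 1 ℚ.+ ι 1))
      ≤⟨ ℚₚ.+-monoˡ-≤ (ι c ℚ.+ (ι 1 ℚ.+ ι 1 ℚ.+ ι 1)) (f≤k 0) ⟩
    ι k ℚ.+ ι 2 ℚ.+ (ι c ℚ.+ ι 3)                 ≡⟨ collect (ι k) (ι 2) (ι c) (ι 3) ⟩
    ι k ℚ.+ ι c ℚ.+ ι 5                           ≡⟨ cong (ℚ._+ ι 5) (ι-+ k c) ⟨
    ι (k + c) ℚ.+ ι 5                             ≡⟨ ι-+ (k + c) 5 ⟨
    ι (k + c + 5)                                 ∎)
    where
    open +-*-Solver
    swap : ∀ p c e → p ℚ.+ e ℚ.+ e ℚ.+ e ≡ p ℚ.- c ℚ.+ (c ℚ.+ (e ℚ.+ e ℚ.+ e))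
    swap = solve 3 (λ p c e → p :+ e :+ e :+ e := p :- c :+ (c :+ (e :+ e :+ e))) refl
    collect : ∀ k u c v → k ℚ.+ u ℚ.+ (c ℚ.+ v) ≡ k ℚ.+ c ℚ.+ (u ℚ.+ v)
    collect = solve 4 (λ k u c v → k :+ u :+ (c :+ v) := k :+ c :+ (u :+ v)) refl

-- Summing reciprocals of powers of two

2⁻-*-2^ : ∀ j → 2⁻ j ℚ.* ι (2 ^ j) ≡ 1ℚ
2⁻-*-2^ zero    = refl
2⁻-*-2^ (suc j) = begin
  ½ ℚ.* 2⁻ j ℚ.* ι (2 * 2 ^ j)
    ≡⟨ cong (½ ℚ.* 2⁻ j ℚ.*_) (trans (cong (λ m → ι (2 ^ j + m)) (+-identityʳ (2 ^ j))) (ι-+ (2 ^ j) (2 ^ j))) ⟩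
  ½ ℚ.* 2⁻ j ℚ.* (ι (2 ^ j) ℚ.+ ι (2 ^ j))
    ≡⟨ solve 3 (λ h x y → h :* x :* (y :+ y) := (h :+ h) :* (x :* y)) refl ½ (2⁻ j) (ι (2 ^ j)) ⟩
  1ℚ ℚ.* (2⁻ j ℚ.* ι (2 ^ j))
    ≡⟨ trans (ℚₚ.*-identityˡ _) (2⁻-*-2^ j) ⟩
  1ℚ ∎
  where
  open ≡-Reasoning
  open +-*-Solver

-- As 2^j is at least 1, the truncation inside `1/1⊔` leaves it unchanged.
1/1⊔-2^ : ∀ j → 1/1⊔ (ι (2 ^ j)) ≡ 2⁻ j
1/1⊔-2^ j = begin
  1/ a                             ≡⟨ ℚₚ.*-identityˡ (1/ a) ⟨
  1ℚ ℚ.* (1/ a)                    ≡⟨ cong (ℚ._* (1/ a)) (2⁻-*-2^ j) ⟨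
  2⁻ j ℚ.* ι (2 ^ j) ℚ.* (1/ a)    ≡⟨ cong (λ b → 2⁻ j ℚ.* b ℚ.* (1/ a)) a≡ ⟨
  2⁻ j ℚ.* a ℚ.* (1/ a)            ≡⟨ ℚₚ.*-assoc (2⁻ j) a (1/ a) ⟩
  2⁻ j ℚ.* (a ℚ.* (1/ a))          ≡⟨ cong (2⁻ j ℚ.*_) (ℚₚ.*-inverseʳ a) ⟩
  2⁻ j ℚ.* 1ℚ                      ≡⟨ ℚₚ.*-identityʳ (2⁻ j) ⟩
  2⁻ j                             ∎
  where
  open ≡-Reasoning
  a : ℚ
  a = 1ℚ ⊔ ι (2 ^ j)
  instance
    a≢0 : ℚ.NonZero a
    a≢0 = ℚₚ.pos⇒nonZero a {{1⊔-pos (ι (2 ^ j))}}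
  a≡ : a ≡ ι (2 ^ j)
  a≡ = ℚₚ.p≤q⇒p⊔q≡q (ι-mono-≤ {1} {2 ^ j} (m^n>0 2 j))

2⁻-suc-≤ : ∀ k → 2⁻ (suc k) ℚ.≤ 2⁻ k
2⁻-suc-≤ k = subst (2⁻ (suc k) ℚ.≤_) (2⁻-half k) (p≤p+q (2⁻ (suc k)) (2⁻-nonNeg (suc k)))

2⁻-antitone : ∀ {m n} → m ≤ n → 2⁻ n ℚ.≤ 2⁻ m
2⁻-antitone m≤n = go (≤⇒≤′ m≤n)
  where
  go : ∀ {m n} → m ≤′ n → 2⁻ n ℚ.≤ 2⁻ m
  go ≤′-refl            = ℚₚ.≤-refl
  go (≤′-step {n} m≤′n) = ℚₚ.≤-trans (2⁻-suc-≤ n) (go m≤′n)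

module _ (u : ℕ → ℚ) (0≤u : ∀ n → 0ℚ ℚ.≤ u n) (u≤2⁻ : ∀ n → u n ℚ.≤ 2⁻ (suc n)) where

  private
    S : ℕ → ℚ
    S zero    = 0ℚ
    S (suc n) = S n ℚ.+ u n

    S-mono : ∀ {m n} → m ≤ n → S m ℚ.≤ S n
    S-mono m≤n = go (≤⇒≤′ m≤n)
      where
      go : ∀ {m n} → m ≤′ n → S m ℚ.≤ S n
      go ≤′-refl            = ℚₚ.≤-refl
      go (≤′-step {n} m≤′n) = ℚₚ.≤-trans (go m≤′n) (p≤p+q (S n) (0≤u n))

    -- The n-th term is at most half of `2⁻ n`, just what the second summand loses. Hence the tail
    -- beyond m is at most `2⁻ m`.
    S+2⁻-antitone : ∀ {m n} → m ≤ n → S n ℚ.+ 2⁻ n ℚ.≤ S m ℚ.+ 2⁻ m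
    S+2⁻-antitone m≤n = go (≤⇒≤′ m≤n)
      where
      step : ∀ n → S (suc n) ℚ.+ 2⁻ (suc n) ℚ.≤ S n ℚ.+ 2⁻ n
      step n = begin
        S n ℚ.+ u n ℚ.+ 2⁻ (suc n)              ≤⟨ ℚₚ.+-monoˡ-≤ _ (ℚₚ.+-monoʳ-≤ (S n) (u≤2⁻ n)) ⟩
        S n ℚ.+ 2⁻ (suc n) ℚ.+ 2⁻ (suc n)       ≡⟨ ℚₚ.+-assoc (S n) _ _ ⟩
        S n ℚ.+ (2⁻ (suc n) ℚ.+ 2⁻ (suc n))     ≡⟨ cong (S n ℚ.+_) (2⁻-half n) ⟩
        S n ℚ.+ 2⁻ n                            ∎
        where open ℚₚ.≤-Reasoning
      go : ∀ {m n} → m ≤′ n → S n ℚ.+ 2⁻ n ℚ.≤ S m ℚ.+ 2⁻ m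
      go ≤′-refl            = ℚₚ.≤-refl
      go (≤′-step {n} m≤′n) = ℚₚ.≤-trans (step n) (go m≤′n)

    S-tail : ∀ {m n} → m ≤ n → S n ℚ.≤ S m ℚ.+ 2⁻ m
    S-tail {m} {n} m≤n = ℚₚ.≤-trans (p≤p+q (S n) (2⁻-nonNeg n)) (S+2⁻-antitone m≤n)

    -- By `S-tail` the partial sums converge fast enough to serve as approximations of their own
    -- limit.
    limit : ℝ
    limit = mkℝ S reg
      where
      reg : ∀ m n → S m ℚ.≤ S n ℚ.+ (2⁻ m ℚ.+ 2⁻ n)
      reg m n with ≤-total m n
      ... | inj₁ m≤n = ℚₚ.≤-trans (S-mono m≤n)
        (p≤p+q (S n) (ℚₚ.+-mono-≤ (2⁻-nonNeg m) (2⁻-nonNeg n)))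
      ... | inj₂ n≤m = ℚₚ.≤-trans (S-tail n≤m)
        (ℚₚ.+-monoʳ-≤ (S n) (subst (2⁻ n ℚ.≤_) (ℚₚ.+-comm (2⁻ n) (2⁻ m)) (p≤p+q (2⁻ n) (2⁻-nonNeg m))))

  summable : ∀ {a} → (∀ n k → approx (a n) k ≡ u n) → Summable a
  summable {a} a≡u = limit , λ ε 0<ε → let j = proj₁ 0<ε in
    -- Comparisons are made at index k = 2 + j, where addition reads the limit and ε at index 3 + j.
    -- By `gap`, ε exceeds the margin at k together with the tail beyond 3 + j.
    3 + j , λ n 3+j≤n →
      (2 + j , lower ε j n 3+j≤n (gap ε 0<ε)) , (2 + j , upper ε j n 3+j≤n (gap ε 0<ε))
    where
    open ℚₚ.≤-Reasoning
    open +-*-Solver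
    ∑≡S : ∀ n k → approx ((∑< n) a) k ≡ S n
    ∑≡S zero    k = refl
    ∑≡S (suc n) k = cong₂ ℚ._+_ (∑≡S n (suc k)) (a≡u n (suc k))
    gap : ∀ ε (0<ε : fromℕ 0 <ℝ ε) → let k = 2 + proj₁ 0<ε in
          2⁻ k ℚ.+ 2⁻ k ℚ.+ 2⁻ (suc k) ℚ.< approx ε (suc k)
    gap ε (j , 0<ε) = +-cancelʳ-<ℚ e (begin-strict
      2⁻ k ℚ.+ 2⁻ k ℚ.+ e ℚ.+ e            ≡⟨ ℚₚ.+-assoc (2⁻ k ℚ.+ 2⁻ k) e e ⟩
      2⁻ k ℚ.+ 2⁻ k ℚ.+ (e ℚ.+ e)          ≡⟨ cong₂ ℚ._+_ (2⁻-half (suc j)) (2⁻-half k) ⟩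
      2⁻ (suc j) ℚ.+ 2⁻ k                  ≤⟨ ℚₚ.+-monoʳ-≤ (2⁻ (suc j)) (2⁻-suc-≤ (suc j)) ⟩
      2⁻ (suc j) ℚ.+ 2⁻ (suc j)            ≡⟨ 2⁻-half j ⟩
      2⁻ j                                 <⟨ +-cancelʳ-<ℚ (2⁻ j) (ℚₚ.<-≤-trans
                                                (subst (ℚ._< approx ε j) (ℚₚ.+-identityˡ _) 0<ε)
                                                (ℚₚ.≤-trans (regular ε j (suc k)) (ℚₚ.≤-reflexive (swap (approx ε (suc k)) (2⁻ j) e)))) ⟩
      approx ε (suc k) ℚ.+ e               ∎)
      where
      k = 2 + j
      e = 2⁻ (suc k)
      swap : ∀ p j e → p ℚ.+ (j ℚ.+ e) ≡ p ℚ.+ e ℚ.+ j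
      swap = solve 3 (λ p j e → p :+ (j :+ e) := p :+ e :+ j) refl
    lower : ∀ ε j n → 3 + j ≤ n → let k = 2 + j in
            2⁻ k ℚ.+ 2⁻ k ℚ.+ 2⁻ (suc k) ℚ.< approx ε (suc k) →
            S (suc k) ℚ.- approx ε (suc k) ℚ.+ (2⁻ k ℚ.+ 2⁻ k) ℚ.< approx ((∑< n) a) k
    lower ε j n k<n small = begin-strict
      S (suc k) ℚ.- x ℚ.+ d      <⟨ ℚₚ.+-monoʳ-< (S (suc k) ℚ.- x) (ℚₚ.≤-<-trans (p≤p+q d (2⁻-nonNeg (suc k))) small) ⟩
      S (suc k) ℚ.- x ℚ.+ x      ≡⟨ p-q+q≡p (S (suc k)) x ⟩
      S (suc k)                  ≤⟨ S-mono k<n ⟩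
      S n                        ≡⟨ ∑≡S n k ⟨
      approx ((∑< n) a) k        ∎
      where
      k = 2 + j
      x = approx ε (suc k)
      d = 2⁻ k ℚ.+ 2⁻ k
    upper : ∀ ε j n → 3 + j ≤ n → let k = 2 + j in
            2⁻ k ℚ.+ 2⁻ k ℚ.+ 2⁻ (suc k) ℚ.< approx ε (suc k) →
            approx ((∑< n) a) k ℚ.+ (2⁻ k ℚ.+ 2⁻ k) ℚ.< S (suc k) ℚ.+ approx ε (suc k)
    upper ε j n k<n small = begin-strict
      approx ((∑< n) a) k ℚ.+ d          ≡⟨ cong (ℚ._+ d) (∑≡S n k) ⟩
      S n ℚ.+ d                          ≤⟨ ℚₚ.+-monoˡ-≤ d (S-tail k<n) ⟩
      S (suc k) ℚ.+ 2⁻ (suc k) ℚ.+ d     ≡⟨ swap (S (suc k)) (2⁻ (suc k)) d ⟩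
      S (suc k) ℚ.+ (d ℚ.+ 2⁻ (suc k))   <⟨ ℚₚ.+-monoʳ-< (S (suc k)) small ⟩
      S (suc k) ℚ.+ approx ε (suc k)     ∎
      where
      k = 2 + j
      d = 2⁻ k ℚ.+ 2⁻ k
      swap : ∀ p e d → p ℚ.+ e ℚ.+ d ≡ p ℚ.+ (d ℚ.+ e)
      swap = solve 3 (λ p e d → p :+ e :+ d := p :+ (d :+ e)) refl

2^-fastGrowing : ∀ {Q : ℕ → ℕ} {q : ℕ → ℝ} (q>1 : ∀ n → fromℕ 1 <ℝ q n) →
                 (∀ n k → approx (q n) k ≡ ι (2 ^ Q n)) → (∀ n → n < Q n) → FastGrowing q q>1
2^-fastGrowing {Q} q>1 q≡2^ n<Q = summable (λ n → 2⁻ (Q n)) (λ n → 2⁻-nonNeg (Q n))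
  (λ n → 2⁻-antitone (n<Q n)) (λ n k → trans (cong 1/1⊔ {y = ι (2 ^ Q n)} (q≡2^ n k)) (1/1⊔-2^ (Q n)))

-- From complexity to avoidance

-- The search recovers x from the code of `unary x` and diverges on all other strings, which makes
-- the domain prefix-free.
onUnary : PartialRecursive 1 → PartialRecursive 1
onUnary θ = comp θ (mu (Rec₂.code isUnary) ∷ [])
  module OnUnary where
  isUnary : Rec₂ {⊥} (λ _ x z → distance (pair x 1) z)
  isUnary = rec₂ (app₂ distance-rec (app₂ pair-rec #0 (lit 1)) #1)

onUnary-complete : ∀ θ {x y} → θ ⟨ x ∷ [] ⟩↦ y → onUnary θ ⟨ pair x 1 ∷ [] ⟩↦ y
onUnary-complete θ {x} θx↦y = e-comp (e-mu
    (λ z z<x → nonzero z (λ eq → <⇒≢ z<x (proj₁ (pair-injective z x (distance≡0⇒≡ _ _ eq)))))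
    (subst (Eval _ _ _) (distance-refl (pair x 1)) (Rec₂.computes isUnary _ x (pair x 1)))
  ∷ []) θx↦y
  where
  open OnUnary θ
  nonzero : ∀ z → distance (pair z 1) (pair x 1) ≢ 0 →
            ∃[ v ] Rec₂.code isUnary ⟨ z ∷ pair x 1 ∷ [] ⟩↦ suc v
  nonzero z d≢0 with distance (pair z 1) (pair x 1) | Rec₂.computes isUnary ⊥-elim z (pair x 1)
  ... | zero  | _ = ⊥-elim (d≢0 refl)
  ... | suc v | p = v , p

onUnary-sound : ∀ θ {z y} → onUnary θ ⟨ z ∷ [] ⟩↦ y → ∃[ x ] z ≡ pair x 1 × θ ⟨ x ∷ [] ⟩↦ y
onUnary-sound θ {z} (e-comp (e-mu {y = x} _ stop ∷ []) θx↦y) =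
  x , sym (distance≡0⇒≡ _ _ (Eval-det _ (Rec₂.computes isUnary ⊥-elim x z) stop)) , θx↦y
  where open OnUnary θ

onUnary-prefixFree : ∀ θ → PrefixFree (onUnary θ)
onUnary-prefixFree θ {τ} {τ′} Mτ Mτ′ τ≤τ′
  with onUnary-sound θ Mτ | onUnary-sound θ Mτ′
... | x , eq , _ | x′ , eq′ , _
  with refl ← encode-injective τ (unary x) (trans eq (sym (encode-unary x)))
     | refl ← encode-injective τ′ (unary x′) (trans eq′ (sym (encode-unary x′)))
  = cong unary (unary-prefixFree x x′ τ≤τ′)

-- Universality of U applied to `onUnary θ`. It speaks of outputs that are codes of strings; as
-- `encode` is onto, these are all numbers.
universal-unary : ∀ {U} → IsUniversal U → ∀ θ → ∃[ ρ ]
  (∀ x y → (U ⟨ encode (ρ ++ unary x) ∷ [] ⟩↦ y) ⇔ (θ ⟨ x ∷ [] ⟩↦ y))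
universal-unary (_ , universal) θ with universal (onUnary θ) (λ {_} {_} {σ} {σ′} → onUnary-prefixFree θ {σ = σ} {σ′})
... | ρ , equiv = ρ , λ x y → bridge x y (encode-surjective y)
  where
  bridge : ∀ x y → ∃[ σ ] encode σ ≡ y →
           (_ ⟨ encode (ρ ++ unary x) ∷ [] ⟩↦ y) ⇔ (θ ⟨ x ∷ [] ⟩↦ y)
  bridge x _ (σ , refl) = mk⇔
    (λ Uτ → unpack (onUnary-sound θ (to (equiv (unary x) σ) Uτ)))
    (λ θx → from (equiv (unary x) σ)
      (subst (λ z → onUnary θ ⟨ z ∷ [] ⟩↦ encode σ) (sym (encode-unary x)) (onUnary-complete θ θx)))
    where
    unpack : ∃[ x′ ] encode (unary x) ≡ pair x′ 1 × (θ ⟨ x′ ∷ [] ⟩↦ encode σ) → θ ⟨ x ∷ [] ⟩↦ encode σ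
    unpack (x′ , eq , θx′)
      with refl ← proj₁ (pair-injective x x′ (trans (sym (encode-unary x)) eq)) = θx′

triple : ℕ → ℕ → ℕ → ℕ
triple u v x = pair u (pair v x)

-- A composition of two affine maps; its slope and intercept become the constants for linear
-- universality.
triple-affine : ∀ u v y x →
  triple u v (y + x) ≡ 2 ^ suc u * 2 ^ suc v * x + triple u v y
triple-affine u v y x = begin
  pair u (pair v (y + x))                            ≡⟨ cong (pair u) (pair-affine v y x) ⟩
  pair u (2 ^ suc v * x + pair v y)                  ≡⟨ cong (pair u) (+-comm _ (pair v y)) ⟩
  pair u (pair v y + 2 ^ suc v * x)                  ≡⟨ pair-affine u (pair v y) _ ⟩
  2 ^ suc u * (2 ^ suc v * x) + triple u v y         ≡⟨ cong (_+ triple u v y) (*-assoc (2 ^ suc u) _ x) ⟨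
  2 ^ suc u * 2 ^ suc v * x + triple u v y           ∎
  where open ≡-Reasoning

y≤pair : ∀ a y → y ≤ pair a y
y≤pair zero    y = m≤m+n y _
y≤pair (suc a) y = m≤n⇒m≤1+n (≤-trans (y≤pair a y) (m≤m+n _ _))

fst³ snd³ thd³ : ℕ → ℕ
fst³ = fst
snd³ n = fst (snd n)
thd³ n = snd (snd n)

snd-triple : ∀ u v x → snd³ (triple u v x) ≡ v
snd-triple u v x = trans (cong fst (snd-pair u (pair v x))) (fst-pair v x)

thd-triple : ∀ u v x → thd³ (triple u v x) ≡ x
thd-triple u v x = trans (cong snd (snd-pair u (pair v x))) (snd-pair v x)

-- The code of the string ρ0ˣ1, if n is the triple of the code of ρ, 2^|ρ| and x.
program : ℕ → ℕ
program n = fst³ n + snd³ n * pair (thd³ n) 1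

program-rec : ∀ {O} → Rec₁ {O} (λ _ → program)
program-rec = rec₁ ((fst-rec $₁ #0) ⊕
  (fst-rec $₁ (snd-rec $₁ #0)) ⊗ app₂ pair-rec (snd-rec $₁ (snd-rec $₁ #0)) (lit 1))

program-triple : ∀ ρ x → program (triple (encode ρ) (2 ^ length ρ) x) ≡ encode (ρ ++ unary x)
program-triple ρ x = begin
  program n                                               ≡⟨ cong₂ _+_ (fst-pair (encode ρ) _)
    (cong₂ _*_ (snd-triple (encode ρ) (2 ^ length ρ) x)
               (cong (λ z → pair z 1) (thd-triple (encode ρ) (2 ^ length ρ) x))) ⟩
  encode ρ + 2 ^ length ρ * pair x 1                      ≡⟨ cong (λ z → encode ρ + 2 ^ length ρ * z) (encode-unary x) ⟨
  encode ρ + 2 ^ length ρ * encode (unary x)              ≡⟨ encode-++ ρ (unary x) ⟨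
  encode (ρ ++ unary x)                                   ∎
  where
  open ≡-Reasoning
  n = triple (encode ρ) (2 ^ length ρ) x

module Delayed (U : PartialRecursive 1) (c : ℕ) where

  -- Constant in the search variable, so that minimisation stops at once if c < n and never
  -- otherwise.
  guard : Rec₂ {⊥} (λ _ _ n → suc c ∸ n)
  guard = rec₂ (lit (suc c) ⊖ #1)

  -- Composition is strict: `proj zero` passes on the program only after the guard has halted. A
  -- domain above c lets n absorb the constant of X in `avoids`.
  ψ : PartialRecursive 1
  ψ = comp U (comp (proj zero) (Rec₁.code program-rec ∷ mu (Rec₂.code guard) ∷ []) ∷ [])

  ψ-complete : ∀ {n y} → c < n → U ⟨ program n ∷ [] ⟩↦ y → ψ ⟨ n ∷ [] ⟩↦ y
  ψ-complete {n} c<n Uy = e-comp (e-comp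
    (Rec₁.computes program-rec ⊥-elim n ∷
     e-mu (λ _ ()) (subst (Eval _ _ _) (m≤n⇒m∸n≡0 c<n) (Rec₂.computes guard ⊥-elim 0 n)) ∷ [])
    e-proj ∷ []) Uy

  ψ-sound : ∀ {n y} → ψ ⟨ n ∷ [] ⟩↦ y → c < n × (U ⟨ program n ∷ [] ⟩↦ y)
  ψ-sound {n} (e-comp (e-comp (p ∷ e-mu {y = z} _ stop ∷ []) e-proj ∷ []) Uy) =
    m∸n≡0⇒m≤n (Eval-det _ (Rec₂.computes guard ⊥-elim z n) stop) ,
    subst (λ w → U ⟨ w ∷ [] ⟩↦ _) (Eval-det _ p (Rec₁.computes program-rec ⊥-elim n)) Uy

  shift : Rec₁ {⊥} (λ _ x → x ∸ suc c)
  shift = rec₁ (#0 ⊖ lit (suc c))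

  -- θ is precomposed with subtraction of c + 1 and only arguments c + 1 + x are used. Their triples
  -- exceed c and pass the guard, and they are still affine in x.
  ψ-linearlyUniversal : IsUniversal U → LinearlyUniversal ψ
  ψ-linearlyUniversal universal θ with universal-unary universal (comp θ (Rec₁.code shift ∷ []))
  ... | ρ , equiv = 2 ^ suc u * 2 ^ suc v , triple u v (suc c) , λ x y →
    subst (λ n → (ψ ⟨ n ∷ [] ⟩↦ y) ⇔ (θ ⟨ x ∷ [] ⟩↦ y)) (triple-affine u v (suc c) x)
      (mk⇔ (λ ψy → θ′-sound (to (equiv (suc c + x) y)
               (subst (λ w → U ⟨ w ∷ [] ⟩↦ y) (program-triple ρ (suc c + x)) (proj₂ (ψ-sound ψy)))))
           (λ θy → ψ-complete (large x)
               (subst (λ w → U ⟨ w ∷ [] ⟩↦ y) (sym (program-triple ρ (suc c + x)))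
                 (from (equiv (suc c + x) y) (θ′-complete θy)))))
    where
    θ′ : PartialRecursive 1
    θ′ = comp θ (Rec₁.code shift ∷ [])
    u = encode ρ
    v = 2 ^ length ρ
    large : ∀ x → c < triple u v (suc c + x)
    large x = ≤-trans (m≤m+n (suc c) x) (≤-trans (y≤pair v _) (y≤pair u _))
    θ′-sound : ∀ {x y} → θ′ ⟨ suc c + x ∷ [] ⟩↦ y → θ ⟨ x ∷ [] ⟩↦ y
    θ′-sound {x} (e-comp (p ∷ []) θy) = subst (λ w → θ ⟨ w ∷ [] ⟩↦ _)
      (trans (Eval-det _ p (Rec₁.computes shift ⊥-elim (suc c + x))) (m+n∸m≡n (suc c) x)) θy
    θ′-complete : ∀ {x y} → θ ⟨ x ∷ [] ⟩↦ y → θ′ ⟨ suc c + x ∷ [] ⟩↦ y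
    θ′-complete {x} θy = e-comp (Rec₁.computes shift ⊥-elim (suc c + x) ∷ [])
      (subst (λ w → θ ⟨ w ∷ [] ⟩↦ _) (sym (m+n∸m≡n (suc c) x)) θy)

encodeBits : (ℕ → ℕ) → ℕ → ℕ
encodeBits Y zero    = 0
encodeBits Y (suc n) = encodeBits Y n + 2 ^ n * suc (Y n)

encodeBits-rec : Rec₁ {⊤} (λ α → encodeBits (α tt))
encodeBits-rec = prec₁ _ 0 (rec₂ (#1 ⊕ (2^-rec $₁ #0) ⊗ (suc-rec $₁ (oracle-rec tt $₁ #0))))
  (λ _ → refl) (λ _ _ → refl)

encodeBits-bit : ∀ {X Y} → (∀ n → Y n ≡ bit (X n)) → ∀ n → encodeBits Y n ≡ encode (X ↾ n)
encodeBits-bit         Y≡X zero    = refl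
encodeBits-bit {X} {Y} Y≡X (suc n) =
  trans (cong₂ (λ e y → e + 2 ^ n * suc y) (encodeBits-bit Y≡X n) (Y≡X n)) (sym (encode-↾ X n))

relativize₁ : ∀ {O f} → Rec₁ {⊥} (λ _ → f) → Rec₁ {O} (λ _ → f)
relativize₁ (mkRec₁ e p) = mkRec₁ (relativize e) λ _ x → relativize-Eval e (p ⊥-elim x)

module FromComplex (U : PartialRecursive 1) (universal : IsUniversal U) {f : ℕ → ℝ} {m : ℕ → ℕ}
  (M : Rec₁ {⊥} (λ _ → m))
  (modulus : ∀ n N c k → m n ≤ N → f N -ℝ fromℕ c ≤ℝ fromℕ k → 6 + n + program n ≤ k + c + 5)
  where

  -- Length of the segment sent at n: at least `m n`, so that `modulus` applies, above n, so that
  -- the reciprocals are summable, and nondecreasing through the partial sums.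
  Q : ℕ → ℕ
  Q n = suc n + partialSum m (suc n)

  -- A power of two, hence with an explicit reciprocal, above all codes of strings of length `Q n`.
  q : ℕ → ℝ
  q n = fromℕ (2 ^ suc (Q n))

  n<Q : ∀ n → n < Q n
  n<Q n = m≤m+n (suc n) _

  m≤Q : ∀ n → m n ≤ Q n
  m≤Q n = ≤-trans (term≤partialSum m ≤-refl) (m≤n+m _ (suc n))

  Q-mono : ∀ {k n} → k ≤ n → Q k ≤ Q n
  Q-mono k≤n = +-mono-≤ (s≤s k≤n) (partialSum-mono m (s≤s k≤n))

  q>1 : ∀ n → fromℕ 1 <ℝ q n
  q>1 n = fromℕ-mono-< {1} {2 ^ suc (Q n)} (^-monoʳ-≤ 2 {1} {suc (Q n)} (s≤s z≤n))

  Q-rec : Rec₁ {⊥} (λ _ → Q)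
  Q-rec = rec₁ ((suc-rec $₁ #0) ⊕ (partialSum-rec M $₁ (suc-rec $₁ #0)))

  q-rec : Rec₁ {⊥} (λ _ n → 2 ^ suc (Q n))
  q-rec = rec₁ (2^-rec $₁ (suc-rec $₁ (Q-rec $₁ #0)))

  Φ : Rec₁ {⊤} (λ α n → encodeBits (α tt) (Q n))
  Φ = rec₁ (encodeBits-rec $₁ (relativize₁ Q-rec $₁ #0))

  q-order : IsOrder q
  q-order = fromℕ-order {λ n → 2 ^ suc (Q n)} q-rec (λ k n k≤n → ^-monoʳ-≤ 2 {suc (Q k)} {suc (Q n)} (s≤s (Q-mono k≤n)))
    (λ b → b , ≤-trans (<⇒≤ (n<2^n b)) (^-monoʳ-≤ 2 {b} {suc (Q b)} (m≤n⇒m≤1+n (<⇒≤ (n<Q b)))))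

  q-fastGrowing : FastGrowing q q>1
  q-fastGrowing = 2^-fastGrowing {λ n → suc (Q n)} {q} q>1 (λ _ _ → refl) (λ n → m≤n⇒m≤1+n (n<Q n))

  reduction : ∀ Z → ⌊ COMPLEX U f ⌋ Z →
              ∃[ Y ] LUA q Y × (∀ n → Eval (λ _ → Z) (Rec₁.code Φ) (n ∷ []) (Y n))
  reduction Z (X , (c , complex) , Z≡X) =
    (λ n → encodeBits Z (Q n)) ,
    ((λ n → fromℕ-mono-< {encodeBits Z (Q n)} {2 ^ suc (Q n)} (bounded n)) ,
     ψ , ψ-linearlyUniversal universal , avoids) ,
    Rec₁.computes Φ (λ _ → Z)
    where
    open Delayed U c
    Y≡ : ∀ n → encodeBits Z (Q n) ≡ encode (X ↾ Q n)
    Y≡ n = encodeBits-bit {X} {Z} Z≡X (Q n)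
    bounded : ∀ n → encodeBits Z (Q n) < 2 ^ suc (Q n)
    bounded n = begin-strict
      encodeBits Z (Q n)               ≡⟨ Y≡ n ⟩
      encode (X ↾ Q n)                 <⟨ <-trans (n<1+n _) (encode<2^ (X ↾ Q n)) ⟩
      2 ^ suc (length (X ↾ Q n))       ≡⟨ cong (λ l → 2 ^ suc l) (length-applyUpTo X (Q n)) ⟩
      2 ^ suc (Q n)                    ∎
      where open ≤-Reasoning
    avoids : ¬ (∃[ n ] ψ ⟨ n ∷ [] ⟩↦ encodeBits Z (Q n))
    -- The string coded by `program n` describes the segment, and its length is at most its code. Of
    -- the 6 in `modulus`, 5 cancels the error and 1 remains for the contradiction, as c < n.
    avoids (n , ψn) with ψ-sound ψn | encode-surjective (program n) | complex (Q n)
    ... | c<n , Un | τ , τ≡ | k , (_ , minimal) , f≤k = 1+n≰n {5 + n + program n} (begin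
      6 + n + program n      ≤⟨ modulus n (Q n) c k (m≤Q n) f≤k ⟩
      k + c + 5              ≤⟨ +-monoˡ-≤ 5 (+-mono-≤ k≤ (<⇒≤ c<n)) ⟩
      program n + n + 5      ≡⟨ swap (program n) n ⟩
      5 + n + program n      ∎)
      where
      open ≤-Reasoning
      swap : ∀ p n → p + n + 5 ≡ 5 + n + p
      swap = solve-∀
      k≤ : k ≤ program n
      k≤ = ≤-trans (minimal τ (subst₂ (λ z w → U ⟨ z ∷ [] ⟩↦ w) (sym τ≡) (Y≡ n) Un))
             (≤-trans (length≤encode τ) (≤-reflexive τ≡))

complex⇒avoiding : (U : PartialRecursive 1) → IsUniversal U → (f : ℕ → ℝ) → IsOrder f →
  Σ (ℕ → ℝ) λ q → Σ (∀ n → fromℕ 1 <ℝ q n) λ q>1 →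
    IsOrder q × FastGrowing q q>1 × (LUA q ≤ₛ ⌊ COMPLEX U f ⌋)
complex⇒avoiding U universal f order =
  let m , M , modulus = order-modulus {f} order {λ n → 6 + n + program n} threshold in
  let open FromComplex U universal {f} {m} M modulus in
  q , q>1 , q-order , q-fastGrowing , Rec₁.code Φ , reduction
  where
  threshold : Rec₁ {⊥} (λ _ n → 6 + n + program n)
  threshold = rec₁ (lit 6 ⊕ #0 ⊕ (program-rec $₁ #0))

-- From avoidance to complexity

module Inverse (W : ℕ → ℕ) where

  -- The largest k with W k ≤ n (0 if there is none), provided W is strictly increasing.
  inverse : ℕ → ℕ
  inverse zero    = 0
  inverse (suc n) = inverse n + (1 ∸ (W (suc (inverse n)) ∸ suc n))

  inverse-rec : Rec₁ {⊥} (λ _ → W) → Rec₁ {⊥} (λ _ → inverse)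
  inverse-rec V = prec₁ _ 0
    (rec₂ (#1 ⊕ (lit 1 ⊖ ((V $₁ (suc-rec $₁ #1)) ⊖ (suc-rec $₁ #0))))) (λ _ → refl) (λ _ _ → refl)

  inverse-mono : ∀ {m n} → m ≤ n → inverse m ≤ inverse n
  inverse-mono m≤n = go (≤⇒≤′ m≤n)
    where
    go : ∀ {m n} → m ≤′ n → inverse m ≤ inverse n
    go ≤′-refl        = ≤-refl
    go (≤′-step m≤′n) = ≤-trans (go m≤′n) (m≤m+n _ _)

  inverse-step : ∀ n → W (suc (inverse n)) ≤ suc n → inverse (suc n) ≡ suc (inverse n)
  inverse-step n W≤ = trans (cong (λ d → inverse n + (1 ∸ d)) (m≤n⇒m∸n≡0 W≤)) (+-comm (inverse n) 1)

  inverse-stay : ∀ n → suc n < W (suc (inverse n)) → inverse (suc n) ≡ inverse n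
  inverse-stay n <W = trans (cong (λ d → inverse n + d) (m≤n⇒m∸n≡0 (m<n⇒0<n∸m <W))) (+-identityʳ _)

  -- When `inverse` has just increased, the condition for the increase is the claim; otherwise the
  -- claim is inherited. The default value 0 may come with W 0 > n, hence the positivity.
  W∘inverse≤ : ∀ n → 0 < inverse n → W (inverse n) ≤ n
  W∘inverse≤ (suc n) 0<i with W (suc (inverse n)) ≤? suc n
  ... | yes W≤ = subst (λ i → W i ≤ suc n) (sym (inverse-step n W≤)) W≤
  ... | no W≰ with eq ← inverse-stay n (≰⇒> W≰) =
    subst (λ i → W i ≤ suc n) (sym eq) (m≤n⇒m≤1+n (W∘inverse≤ n (subst (0 <_) eq 0<i)))

  -- Once n has passed `W (suc b)`, an inverse still equal to b increases at the next step.
  inverse-unbounded : ∀ b → ∃[ n ] b ≤ inverse n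
  inverse-unbounded zero = 0 , z≤n
  inverse-unbounded (suc b) with inverse-unbounded b
  ... | n , b≤ with m≤n⇒m<n∨m≡n (≤-trans b≤ (inverse-mono (m≤m+n n (W (suc b)))))
  ... | inj₁ b< = n + W (suc b) , b<
  ... | inj₂ b≡ = suc N , ≤-reflexive (sym (trans (inverse-step N W≤) (cong suc (sym b≡))))
    where
    N = n + W (suc b)
    W≤ : W (suc (inverse N)) ≤ suc N
    W≤ = m≤n⇒m≤1+n (subst (λ i → W (suc i) ≤ N) b≡ (m≤n+m (W (suc b)) n))

module FromAvoiding (em : ExcludedMiddle 0ℓ) (U : PartialRecursive 1) (universal : IsUniversal U) where

  -- Having a description of a given length is not a decidable property, so the existence of K rests
  -- on excluded middle.
  minimum : (P : ℕ → Set) → ∀ n → P n → ∃[ k ] P k × (∀ j → P j → k ≤ j)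
  minimum P = <-rec _ step
    where
    step : ∀ n → (∀ {m} → m < n → P m → ∃[ k ] P k × (∀ j → P j → k ≤ j)) →
           P n → ∃[ k ] P k × (∀ j → P j → k ≤ j)
    step n rec Pn with em {∃[ m ] m < n × P m}
    ... | yes (m , m<n , Pm) = rec m<n Pm
    ... | no none            = n , Pn , λ j Pj → ≮⇒≥ λ j<n → none (j , j<n , Pj)

  K-exists : ∀ σ → ∃[ k ] K[ U ] σ is k
  -- Simulating the identity provides every string with some description.
  K-exists σ with universal-unary universal (proj zero)
  ... | ρ , equiv with minimum (λ k → ∃[ τ ] (U ⟪ τ ⟫↦ σ) × length τ ≡ k) _
                         (ρ ++ unary (encode σ) , from (equiv (encode σ) (encode σ)) e-proj , refl)
  ... | k , shortest , minimal = k , shortest , λ τ Uτ → minimal (length τ) (τ , Uτ , refl)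

  graph : (ℕ → ℕ) → ℕ → Bool
  graph X n = X (fst n) ≡ᵇ snd n

  lookup#-graph : ∀ X {i j n} → pair i j < n →
                  lookup# (pair i j) (encode (graph X ↾ n)) ≡ 1 ∸ distance (X i) j
  lookup#-graph X {i} {j} lt = trans (lookup#-↾ (graph X) lt)
    (trans (cong₂ (λ i′ j′ → bit (X i′ ≡ᵇ j′)) (fst-pair i j) (snd-pair i j)) (sym (1∸distance (X i) j)))

  graph-rec : Rec₁ {⊤} (λ α n → 1 ∸ distance (α tt (fst n)) (snd n))
  graph-rec = rec₁ (lit 1 ⊖ app₂ distance-rec (oracle-rec tt $₁ (fst-rec $₁ #0)) (snd-rec $₁ #0))

  -- Vanishes when the segment coded by s records the value j at i. The search variable comes first,
  -- as `mu` demands.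
  test : Rec₃ {⊥} (λ _ j i s → 1 ∸ lookup# (pair i j) s)
  test = rec₃ (lit 1 ⊖ app₂ lookup#-rec (app₂ pair-rec #1 #0) #2)

  -- The coefficients are stored in z itself. Thus `predict` can aim at the position assigned to z
  -- by the constants obtained for `predict`, without the recursion theorem.
  argument : Rec₁ {⊥} (λ _ z → fst³ z * z + snd³ z)
  argument = rec₁ ((fst-rec $₁ #0) ⊗ #0 ⊕ (fst-rec $₁ (snd-rec $₁ #0)))

  input : Rec₁ {⊥} (λ _ z → thd³ z)
  input = rec₁ (snd-rec $₁ (snd-rec $₁ #0))

  predict : PartialRecursive 1
  predict = comp (mu (Rec₃.code test))
    (Rec₁.code argument ∷ comp U (Rec₁.code input ∷ []) ∷ [])

  -- As `pair i` is monotone, every bit inspected on the way to `X i` lies in the segment.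
  predict-correct : ∀ X a b x n → let i = a * triple a b x + b in
    U ⟨ x ∷ [] ⟩↦ encode (graph X ↾ n) → pair i (X i) < n → predict ⟨ triple a b x ∷ [] ⟩↦ X i
  predict-correct X a b x n Ux i<n = e-comp
    (subst (Eval _ _ _) argument≡ (Rec₁.computes argument ⊥-elim z) ∷
     e-comp (subst (Eval _ _ _) (thd-triple a b x) (Rec₁.computes input ⊥-elim z) ∷ []) Ux ∷ [])
    (e-mu (λ j j<Xi → 0 , evaluate (≤-<-trans (pair-monoʳ i (<⇒≤ j<Xi)) i<n) (differ j (≢-sym (<⇒≢ j<Xi))))
          (evaluate i<n (cong (λ d → 1 ∸ (1 ∸ d)) (distance-refl (X i)))))
    where
    z = triple a b x
    i = a * z + b
    s = encode (graph X ↾ n)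
    argument≡ : fst³ z * z + snd³ z ≡ i
    argument≡ = cong₂ (λ u v → u * z + v) (fst-pair a (pair b x)) (snd-triple a b x)
    evaluate : ∀ {j v} → pair i j < n → 1 ∸ (1 ∸ distance (X i) j) ≡ v →
               Rec₃.code test ⟨ j ∷ i ∷ s ∷ [] ⟩↦ v
    evaluate {j} lt eq = subst (Eval _ _ _)
      (trans (cong (1 ∸_) (lookup#-graph X {i} {j} lt)) eq) (Rec₃.computes test ⊥-elim j i s)
    differ : ∀ j → X i ≢ j → 1 ∸ (1 ∸ distance (X i) j) ≡ 1
    differ j Xi≢j with distance (X i) j in eq
    ... | zero  = ⊥-elim (Xi≢j (distance≡0⇒≡ _ _ eq))
    ... | suc d = cong (1 ∸_) (0∸n≡0 d)

  module _ {b : ℕ → ℕ} (B : Rec₁ {⊥} (λ _ → b)) where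

    -- A segment of the graph of this length contains the value at i of every function bounded by b.
    β : ℕ → ℕ
    β i = suc (pair i (b i))

    -- The summand 2 * k makes the inverse of W sub-identical.
    W : ℕ → ℕ
    W k = 2 * k + partialSum β (2 ^ k)

    open Inverse W

    W-rec : Rec₁ {⊥} (λ _ → W)
    W-rec = rec₁ (lit 2 ⊗ #0 ⊕ (partialSum-rec β-rec $₁ (2^-rec $₁ #0)))
      where
      β-rec : Rec₁ {⊥} (λ _ → β)
      β-rec = rec₁ (suc-rec $₁ app₂ pair-rec #0 (B $₁ #0))

    g : ℕ → ℝ
    g n = fromℕ (inverse n)

    g-order : IsOrder g
    g-order = fromℕ-order (inverse-rec W-rec) (λ _ _ → inverse-mono) inverse-unbounded

    g-subIdentical : SubIdentical g
    -- If `inverse n` is positive, then 2 * inverse n ≤ W (inverse n) ≤ n. So `inverse n` is at most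
    -- n/2, and c at most n/2 once n ≥ 2c.
    g-subIdentical = fromℕ-subIdentical λ c → 2 * c , gap c
      where
      gap : ∀ c n → 2 * c ≤ n → c + inverse n ≤ n
      gap c n 2c≤n with inverse n | W∘inverse≤ n
      ... | zero  | _  = ≤-trans (≤-reflexive (+-identityʳ c)) (≤-trans (m≤m+n c _) 2c≤n)
      ... | suc k | W≤ = *-cancelˡ-≤ 2 (begin
        2 * (c + suc k)       ≡⟨ *-distribˡ-+ 2 c (suc k) ⟩
        2 * c + 2 * suc k     ≤⟨ +-mono-≤ 2c≤n (≤-trans (m≤m+n _ _) (W≤ (s≤s z≤n))) ⟩
        n + n                 ≡⟨ cong (λ m → n + m) (+-identityʳ n) ⟨
        2 * n                 ∎)
        where open ≤-Reasoning

    -- The sum in `W k` runs over all i < 2^k, so a segment of length `W k` reaches past the graph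
    -- point at each of them.
    covers : ∀ (X : ℕ → ℕ) → (∀ i → X i ≤ b i) → ∀ {i} n → 0 < inverse n → i < 2 ^ inverse n → pair i (X i) < n
    covers X X≤b {i} n 0<g i<2^g = begin-strict
      pair i (X i)                            ≤⟨ pair-monoʳ i (X≤b i) ⟩
      pair i (b i)                            <⟨ term≤partialSum β i<2^g ⟩
      partialSum β (2 ^ inverse n)            ≤⟨ m≤n+m _ (2 * inverse n) ⟩
      W (inverse n)                           ≤⟨ W∘inverse≤ n 0<g ⟩
      n                                       ∎
      where open ≤-Reasoning

    -- Linear universality is applied to `predict`. A description τ with length τ + c < inverse n
    -- would put the position i for τ below 2^(inverse n), so by `covers` the prediction succeeds
    -- and ψ takes the value `X i` at i.
    graph-complex : ∀ (X : ℕ → ℕ) → (∀ i → X i ≤ b i) → ∀ ψ → LinearlyUniversal ψ →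
                    ¬ (∃[ n ] ψ ⟨ n ∷ [] ⟩↦ X n) → COMPLEX U g (graph X)
    graph-complex X X≤b ψ universalψ avoids with universalψ predict
    ... | a , a′ , equiv = c , λ n →
      let k , K = K-exists (graph X ↾ n) in
      k , K , fromℕ-∸-≤ {inverse n} {c} {k} (≮⇒≥ (short n k (proj₁ K)))
      where
      u v c : ℕ
      u = a * (2 ^ suc a * 2 ^ suc a′)
      v = a * triple a a′ 0 + a′
      c = u + v
      position : ∀ x → a * triple a a′ x + a′ ≡ u * x + v
      position x = trans (cong (λ t → a * t + a′) (triple-affine a a′ 0 x))
        (rearrange a (2 ^ suc a * 2 ^ suc a′) x (triple a a′ 0) a′)
        where
        rearrange : ∀ a e x t b → a * (e * x + t) + b ≡ a * e * x + (a * t + b)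
        rearrange = solve-∀
      -- The position is u x + v with x < 2^(k+1), hence at most (u + v) 2^(k+1), which is below
      -- 2^(c+k+1) because c = u + v < 2^c. The strictness of k + c < G absorbs the 1 in the
      -- exponent.
      small : ∀ {x k G} → 2 + x ≤ 2 ^ suc k → k + c < G → a * triple a a′ x + a′ < 2 ^ G
      small {x} {k} {G} x< kc<G = begin-strict
        a * triple a a′ x + a′           ≡⟨ position x ⟩
        u * x + v                        ≤⟨ +-mono-≤ (*-monoʳ-≤ u (≤-trans (m≤n+m x 2) x<))
                                              (≤-trans (≤-reflexive (sym (*-identityʳ v))) (*-monoʳ-≤ v (m^n>0 2 (suc k)))) ⟩
        u * 2 ^ suc k + v * 2 ^ suc k    ≡⟨ *-distribʳ-+ (2 ^ suc k) u v ⟨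
        c * 2 ^ suc k                    <⟨ *-monoˡ-< (2 ^ suc k) {{m^n≢0 2 (suc k)}} (n<2^n c) ⟩
        2 ^ c * 2 ^ suc k                ≡⟨ ^-distribˡ-+-* 2 c (suc k) ⟨
        2 ^ (c + suc k)                  ≤⟨ ^-monoʳ-≤ 2 (≤-trans (≤-reflexive (trans (+-suc c k) (cong suc (+-comm c k)))) kc<G) ⟩
        2 ^ G                            ∎
        where open ≤-Reasoning
      short : ∀ n k → (∃[ τ ] (U ⟪ τ ⟫↦ (graph X ↾ n)) × length τ ≡ k) → ¬ (k + c < inverse n)
      short n _ (τ , Uτ , refl) k+c<g = avoids
        (_ , from (equiv (triple a a′ x) (X i))
               (predict-correct X a a′ x n Uτ
                 (covers X X≤b {i} n (≤-trans (s≤s z≤n) k+c<g) (small {x} {length τ} (encode<2^ τ) k+c<g))))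
        where
        x = encode τ
        i = a * triple a a′ x + a′

avoiding⇒complex : ExcludedMiddle 0ℓ → (U : PartialRecursive 1) → IsUniversal U →
  (p : ℕ → ℝ) → IsOrder p →
  Σ (ℕ → ℝ) λ g → (∀ n → fromℕ 0 ≤ℝ g n) × IsOrder g × SubIdentical g × (⌊ COMPLEX U g ⌋ ≤ₛ LUA p)
avoiding⇒complex em U universal p (computable , _) =
  let b , B , X≤b = computable-bound {p} computable in
  g B , (λ n → fromℕ-mono-≤ {0} {Inverse.inverse (W B) n} z≤n) , g-order B , g-subIdentical B , Rec₁.code graph-rec ,
  λ X (X<p , ψ , universalψ , avoids) →
    (λ n → 1 ∸ distance (X (fst n)) (snd n)) ,
    (graph X , graph-complex B X (λ n → X≤b n (X n) (X<p n)) ψ universalψ avoids ,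
     λ n → 1∸distance (X (fst n)) (snd n)) ,
    Rec₁.computes graph-rec (λ _ → X)
  where open FromAvoiding em U universal

mainTheorem1 :
  ExcludedMiddle 0ℓ →
  (U : PartialRecursive 1) → IsUniversal U →
  ((f : ℕ → ℝ) → (∀ n → fromℕ 0 ≤ℝ f n) → IsOrder f → SubIdentical f →
    Σ (ℕ → ℝ) λ q → Σ (∀ n → fromℕ 1 <ℝ q n) λ q>1 →
      IsOrder q × FastGrowing q q>1 × (LUA q ≤ₛ ⌊ COMPLEX U f ⌋))
  ×
  ((p : ℕ → ℝ) → (p>1 : ∀ n → fromℕ 1 <ℝ p n) → IsOrder p → FastGrowing p p>1 →
    Σ (ℕ → ℝ) λ g →
      (∀ n → fromℕ 0 ≤ℝ g n) × IsOrder g × SubIdentical g × (⌊ COMPLEX U g ⌋ ≤ₛ LUA p))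
mainTheorem1 em U universal =
  (λ f _ order _ → complex⇒avoiding U universal f order) ,
  (λ p _ order _ → avoiding⇒complex em U universal p order)
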